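{- The category $\mathbf{2}\text{ - }\mathsf{GradMon}$ of $\mathbf{2}$-graded monoidal categories is isomorphic to the category $\mathsf{Eff}$ of strict effectful categories and effectful functors.
   Context: **PCMs.** A partial commutative monoid (PCM) $(E,\oplus,0)$ is a set $E$ with a partial function $\oplus:E\times E\rightharpoonup E$ and an element $0\in E$ such that $a\oplus b\simeq b\oplus a$, $a\oplus 0=a=0\oplus a$, $(a\oplus b)\oplus c\simeq a\oplus(b\oplus c)$, where $\simeq$ means: if either side is defined then both are, and they are equal. Write $a\perp b$ when $a\oplus b$ is defined. The extension preorder on $E$ is: $a\leqslant b$ iff there is $c$ with $a\oplus c=b$. The PCM $\mathbf{2}$ has elements $0,1$ with $0\oplus0=0$, $0\oplus1=1\oplus0=1$, and $1\oplus1$ undefined. **Graded monoidal categories.** For a PCM $E$, an $E$-graded monoidal category $\mathbb{C}$ consists of: a monoid of objects $(\mathbb{C}_{\mathrm{obj}},\otimes,I)$; for each $a\in E$ a category $\mathbb{C}_a$ with set of objects $\mathbb{C}_{\mathrm{obj}}$, hom-sets $\mathbb{C}_a(X;Y)$, composition written diagrammatically $f;g$; the identities of $\mathbb{C}_0$ are written $\mathrm{id}_X$; for each $a\leqslant b$ an identity-on-objects functor $(-)_a^b:\mathbb{C}_a\to\mathbb{C}_b$ (regrading; the identity in $\mathbb{C}_a$ is $(\mathrm{id}_X)_0^a$); for each $a\perp b$ operations $\otimes_{a,b}:\mathbb{C}_a(X;Y)\times\mathbb{C}_b(X';Y')\to\mathbb{C}_{a\oplus b}(X\otimes X';Y\otimes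 Y')$. Axioms, whenever well typed: $f_a^a=f$ and $(f_a^b)_b^c=f_a^c$; $(f\otimes g)_{a\oplus b}^{c\oplus d}=f_a^c\otimes g_b^d$ for $f\in\mathbb{C}_a$, $g\in\mathbb{C}_b$, $a\leqslant c$, $b\leqslant d$, $c\perp d$; $f\otimes\mathrm{id}_I=f=\mathrm{id}_I\otimes f$ and $(f\otimes g)\otimes h=f\otimes(g\otimes h)$; $\mathrm{id}_X\otimes\mathrm{id}_Y=\mathrm{id}_{X\otimes Y}$; $(f\otimes g);(h\otimes k)=(f;h)\otimes(g;k)$ for $f\in\mathbb{C}_a(X;Y)$, $h\in\mathbb{C}_a(Y;Z)$, $g\in\mathbb{C}_b(X';Y')$, $k\in\mathbb{C}_b(Y';Z')$. **Morphisms.** $\mathbf{2}\text{ - }\mathsf{GradMon}$ has $\mathbf{2}$-graded monoidal categories as objects; a morphism $M:\mathbb{C}\to\mathbb{D}$ is a monoid homomorphism $M:\mathbb{C}_{\mathrm{obj}}\to\mathbb{D}_{\mathrm{obj}}$ with, for each $e\in\mathbf{2}$, a functor $M_e:\mathbb{C}_e\to\mathbb{D}_e$ with action $M$ on objects, such that $M_{e\oplus e'}(g\otimes h)=M_e(g)\otimes M_{e'}(h)$ for $g\in\mathbb{C}_e$, $h\in\mathbb{C}_{e'}$, $e\perp e'$, and $M_f(g_e^f)=M_e(g)_e^f$ for $e\leqslant f$. Composition is componentwise. **Effectful categories.** A strict monoidal functor is a functor that is a monoid homomorphism on objects and preserves $\otimes$ of morphisms. A strict premonoidal category is a category with an object $A\otimes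 B$ for each pair of objects, an object $I$, functors $A\ltimes-$ sending object $B$ to $A\otimes B$ and functors $-\rtimes A$ sending object $B$ to $B\otimes A$, such that $\otimes$ on objects is associative and unital with unit $I$, and $(A\ltimes f)\rtimes B=A\ltimes(f\rtimes B)$, $(A\otimes B)\ltimes f=A\ltimes(B\ltimes f)$, $f\rtimes(A\otimes B)=(f\rtimes A)\rtimes B$, $I\ltimes f=f=f\rtimes I$. A morphism $f:A\to B$ is central if for every $g:C\to D$, $(A\ltimes g);(f\rtimes D)=(f\rtimes C);(B\ltimes g)$ and $(g\rtimes A);(D\ltimes f)=(C\ltimes f);(g\rtimes B)$. A strict premonoidal functor is a functor that is a monoid homomorphism on objects and satisfies $F(A\ltimes f)=F(A)\ltimes F(f)$, $F(f\rtimes A)=F(f)\rtimes F(A)$; a strict monoidal category is regarded as premonoidal via $A\ltimes f=\mathrm{id}_A\otimes f$, $f\rtimes A=f\otimes\mathrm{id}_A$. A strict effectful category $(\mathbb{V},\mathbb{C},\eta)$ is a strict monoidal category $\mathbb{V}$, a strict premonoidal category $\mathbb{C}$, and an identity-on-objects strict premonoidal functor $\eta:\mathbb{V}\to\mathbb{C}$ all of whose values on morphisms are central. An effectful functor $(F_0,F_1):(\mathbb{V},\mathbb{C},\eta)\to(\mathbb{V}',\mathbb{C}',\eta')$ is a strict monoidal functor $F_0:\mathbb{V}\to\mathbb{V}'$ and a strict premonoidal functor $F_1:\mathbb{C}\to\mathbb{C}'$ with $F_1\circ\eta=\eta'\circ F_0$. -}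

module Defs where

-- Sets are types and equality is _≡_.  This development uses axiom K
-- (uniqueness of identity proofs), so that every type is a set.

open import Level using (Level; _⊔_; suc; Setω)
open import Data.Fin.Base using (Fin)
open import Data.Fin.Patterns using (0F; 1F)
open import Data.Maybe.Base using (Maybe; just; nothing; _>>=_)
open import Data.Product.Base using (∃; _,_)
open import Function.Base using (id; _∘_)
open import Algebra.Structures using (IsMonoid)
open import Algebra.Bundles using (RawMonoid)
open import Algebra.Morphism.Structures using (module MonoidMorphisms)
import Algebra.Morphism.Construct.Identity as Identity
import Algebra.Morphism.Construct.Composition as Composition
open import Axiom.Extensionality.Propositional
  using (Extensionality; implicit-extensionality)
open import Axiom.UniquenessOfIdentityProofs.WithK using (uip)
open import Relation.Binary.PropositionalEquality.Core as ≡
  using (_≡_; refl; cong)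
open import Relation.Binary.HeterogeneousEquality as ≅
  using (_≅_; refl; ≅-irrelevant; ≡-to-≅)

FunExt : Setω
FunExt = ∀ {a b} → Extensionality a b

------------------------------------------------------------------------
-- Categories and functors

-- Several categories below share one set of objects, so a category is
-- presented as structure over its set of objects, and a functor as
-- structure over its action on objects.

record CategoryOn {o} (Obj : Set o) (ℓ : Level) : Set (o ⊔ suc ℓ) where
  infixl 5 _⨾_
  field
    Hom : Obj → Obj → Set ℓ
    idn : ∀ {X} → Hom X X
    _⨾_ : ∀ {X Y Z} → Hom X Y → Hom Y Z → Hom X Z

    identityˡ : ∀ {X Y} (f : Hom X Y) → idn ⨾ f ≡ f
    identityʳ : ∀ {X Y} (f : Hom X Y) → f ⨾ idn ≡ f
    assoc     : ∀ {W X Y Z} (f : Hom W X) (g : Hom X Y) (h : Hom Y Z) →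
                (f ⨾ g) ⨾ h ≡ f ⨾ (g ⨾ h)

record FunctorOver {o o′ ℓ ℓ′} {Obj : Set o} {Obj′ : Set o′}
                   (C : CategoryOn Obj ℓ) (D : CategoryOn Obj′ ℓ′)
                   (F₀ : Obj → Obj′) : Set (o ⊔ ℓ ⊔ ℓ′) where
  private
    module C = CategoryOn C
    module D = CategoryOn D
  field
    map      : ∀ {X Y} → C.Hom X Y → D.Hom (F₀ X) (F₀ Y)
    map-id   : ∀ {X} → map (C.idn {X}) ≡ D.idn
    map-comp : ∀ {X Y Z} (f : C.Hom X Y) (g : C.Hom Y Z) →
               map (f C.⨾ g) ≡ map f D.⨾ map g

  map-≅ : ∀ {X Y X′ Y′} {f : C.Hom X Y} {g : C.Hom X′ Y′} →
          X ≡ X′ → Y ≡ Y′ → f ≅ g → map f ≅ map g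
  map-≅ refl refl refl = refl

idOver : ∀ {o ℓ} {Obj : Set o} (C : CategoryOn Obj ℓ) → FunctorOver C C id
idOver C = record { map = id ; map-id = refl ; map-comp = λ _ _ → refl }

module _ {o o′ o″ ℓ ℓ′ ℓ″} {Obj : Set o} {Obj′ : Set o′} {Obj″ : Set o″}
         {C : CategoryOn Obj ℓ} {D : CategoryOn Obj′ ℓ′} {E : CategoryOn Obj″ ℓ″}
         {G₀ : Obj′ → Obj″} {F₀ : Obj → Obj′} where

  _∘Over_ : FunctorOver D E G₀ → FunctorOver C D F₀ → FunctorOver C E (G₀ ∘ F₀)
  G ∘Over F = record
    { map      = G.map ∘ F.map
    ; map-id   = ≡.trans (cong G.map F.map-id) G.map-id
    ; map-comp = λ f g → ≡.trans (cong G.map (F.map-comp f g)) (G.map-comp _ _)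
    }
    where
      module F = FunctorOver F
      module G = FunctorOver G

record Category (o ℓ : Level) : Set (suc (o ⊔ ℓ)) where
  field
    Obj        : Set o
    categoryOn : CategoryOn Obj ℓ
  open CategoryOn categoryOn public

record Functor {o ℓ o′ ℓ′} (C : Category o ℓ) (D : Category o′ ℓ′) :
               Set (o ⊔ ℓ ⊔ o′ ⊔ ℓ′) where
  private
    module C = Category C
    module D = Category D
  field
    F₀          : C.Obj → D.Obj
    functorOver : FunctorOver C.categoryOn D.categoryOn F₀
  open FunctorOver functorOver public

idF : ∀ {o ℓ} (C : Category o ℓ) → Functor C C
idF C = record { F₀ = id ; functorOver = idOver (Category.categoryOn C) }

_∘F_ : ∀ {o ℓ o′ ℓ′ o″ ℓ″}
         {C : Category o ℓ} {D : Category o′ ℓ′} {E : Category o″ ℓ″} →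
       Functor D E → Functor C D → Functor C E
G ∘F F = record
  { F₀          = Functor.F₀ G ∘ Functor.F₀ F
  ; functorOver = Functor.functorOver G ∘Over Functor.functorOver F
  }

-- The functors are mutually inverse on the nose: this is isomorphism,
-- not equivalence, of categories.
record IsomorphicCategories {o ℓ o′ ℓ′} (C : Category o ℓ) (D : Category o′ ℓ′) :
                            Set (o ⊔ ℓ ⊔ o′ ⊔ ℓ′) where
  field
    to      : Functor C D
    from    : Functor D C
    from∘to : from ∘F to ≡ idF C
    to∘from : to ∘F from ≡ idF D

------------------------------------------------------------------------
-- Monoids of objects

record ObjMonoid (o : Level) : Set (suc o) where
  infixr 7 _⊗_
  field
    Obj      : Set o
    _⊗_      : Obj → Obj → Obj
    I        : Obj
    isMonoid : IsMonoid _≡_ _⊗_ I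

  open IsMonoid isMonoid public using ()
    renaming (assoc to ⊗-assoc; identityˡ to ⊗-identityˡ; identityʳ to ⊗-identityʳ)

  rawMonoid : RawMonoid o o
  rawMonoid = record { Carrier = Obj ; _≈_ = _≡_ ; _∙_ = _⊗_ ; ε = I }

IsMonoidHom : ∀ {o o′} (M : ObjMonoid o) (N : ObjMonoid o′) →
              (ObjMonoid.Obj M → ObjMonoid.Obj N) → Set (o ⊔ o′)
IsMonoidHom M N =
  MonoidMorphisms.IsMonoidHomomorphism (ObjMonoid.rawMonoid M) (ObjMonoid.rawMonoid N)

isMonoidHom-id : ∀ {o} (M : ObjMonoid o) → IsMonoidHom M M id
isMonoidHom-id M = Identity.isMonoidHomomorphism (ObjMonoid.rawMonoid M) refl

isMonoidHom-∘ : ∀ {o o′ o″}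
                  (M : ObjMonoid o) (N : ObjMonoid o′) (P : ObjMonoid o″)
                  {g : ObjMonoid.Obj N → ObjMonoid.Obj P}
                  {f : ObjMonoid.Obj M → ObjMonoid.Obj N} →
                IsMonoidHom N P g → IsMonoidHom M N f → IsMonoidHom M P (g ∘ f)
isMonoidHom-∘ _ _ _ g-hom f-hom =
  Composition.isMonoidHomomorphism ≡.trans f-hom g-hom

------------------------------------------------------------------------
-- Partial commutative monoids

-- A partial function into E is a function into Maybe E, and Kleene
-- equality is then equality in Maybe E.
record PCM (e : Level) : Set (suc e) where
  infixl 6 _⊕_
  infix 4 _≤_ _⊥_
  field
    Carrier : Set e
    _⊕_     : Carrier → Carrier → Maybe Carrier
    0#      : Carrier

    comm      : ∀ a b → a ⊕ b ≡ b ⊕ a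
    identityʳ : ∀ a → a ⊕ 0# ≡ just a
    identityˡ : ∀ a → 0# ⊕ a ≡ just a
    assoc     : ∀ a b c → ((a ⊕ b) >>= λ ab → ab ⊕ c) ≡ ((b ⊕ c) >>= λ bc → a ⊕ bc)

  _⊥_ : Carrier → Carrier → Set e
  a ⊥ b = ∃ λ c → a ⊕ b ≡ just c

  _≤_ : Carrier → Carrier → Set e
  a ≤ b = ∃ λ c → a ⊕ c ≡ just b

  0≤ : ∀ a → 0# ≤ a
  0≤ a = a , identityˡ a

𝟚 : PCM Level.zero
𝟚 = record
  { Carrier   = Fin 2
  ; _⊕_       = _⊕_
  ; 0#        = 0F
  ; comm      = λ { 0F 0F → refl ; 0F 1F → refl ; 1F 0F → refl ; 1F 1F → refl }
  ; identityʳ = λ { 0F → refl ; 1F → refl }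
  ; identityˡ = λ { 0F → refl ; 1F → refl }
  ; assoc     = λ { 0F 0F _ → refl
                  ; 0F 1F 0F → refl ; 0F 1F 1F → refl
                  ; 1F 0F 0F → refl ; 1F 0F 1F → refl
                  ; 1F 1F 0F → refl ; 1F 1F 1F → refl }
  }
  where
    _⊕_ : Fin 2 → Fin 2 → Maybe (Fin 2)
    0F ⊕ b  = just b
    1F ⊕ 0F = just 1F
    1F ⊕ 1F = nothing

------------------------------------------------------------------------
-- Graded monoidal categories

-- The value c of a ⊕ b is named by a proof of a ⊕ b ≡ just c, which is
-- also the evidence that a ⊥ b; such a c is unique.  Equations between
-- morphisms whose endpoints agree only up to the monoid laws of objects
-- use heterogeneous equality.
--
-- Although a ≤ b may have several witnesses, regrading does not depend
-- on the witness: regrade-refl and regrade-trans range over all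
-- witnesses, so for p, p′ : a ≤ b and r : a ≤ a,
-- regrade p f = regrade p (regrade r f) = regrade p′ f.
record GradedMonoidal {e} (E : PCM e) (o ℓ : Level) : Set (e ⊔ suc (o ⊔ ℓ)) where
  private module E = PCM E
  open E using (_⊕_; 0#; _≤_)
  field
    monoid : ObjMonoid o
  open ObjMonoid monoid public
  field
    cat     : E.Carrier → CategoryOn Obj ℓ
    regrade : ∀ {a b} → a ≤ b → FunctorOver (cat a) (cat b) id

  Hom : E.Carrier → Obj → Obj → Set ℓ
  Hom a = CategoryOn.Hom (cat a)

  _⨾_ : ∀ {a X Y Z} → Hom a X Y → Hom a Y Z → Hom a X Z
  _⨾_ {a} = CategoryOn._⨾_ (cat a)

  idₘ : ∀ X → Hom 0# X X
  idₘ X = CategoryOn.idn (cat 0#)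

  _↑_ : ∀ {a b X Y} → Hom a X Y → a ≤ b → Hom b X Y
  f ↑ p = FunctorOver.map (regrade p) f

  field
    tensor : ∀ {a b c} → a ⊕ b ≡ just c → ∀ {X Y X′ Y′} →
             Hom a X Y → Hom b X′ Y′ → Hom c (X ⊗ X′) (Y ⊗ Y′)

    regrade-refl  : ∀ {a X Y} (p : a ≤ a) (f : Hom a X Y) → f ↑ p ≡ f
    regrade-trans : ∀ {a b c X Y} (p : a ≤ b) (q : b ≤ c) (r : a ≤ c) (f : Hom a X Y) →
                    (f ↑ p) ↑ q ≡ f ↑ r

    -- s and r always exist when p, q and t do.
    regrade-tensor : ∀ {a b c d ab cd X Y X′ Y′}
                     (p : a ≤ c) (q : b ≤ d)
                     (s : a ⊕ b ≡ just ab) (t : c ⊕ d ≡ just cd) (r : ab ≤ cd)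
                     (f : Hom a X Y) (g : Hom b X′ Y′) →
                     tensor s f g ↑ r ≡ tensor t (f ↑ p) (g ↑ q)

    tensor-identityʳ : ∀ {a X Y} (s : a ⊕ 0# ≡ just a) (f : Hom a X Y) →
                       tensor s f (idₘ I) ≅ f
    tensor-identityˡ : ∀ {a X Y} (s : 0# ⊕ a ≡ just a) (f : Hom a X Y) →
                       tensor s (idₘ I) f ≅ f
    tensor-assoc     : ∀ {a b c ab bc abc X Y X′ Y′ X″ Y″}
                       (s : a ⊕ b ≡ just ab) (t : ab ⊕ c ≡ just abc)
                       (u : b ⊕ c ≡ just bc) (v : a ⊕ bc ≡ just abc)
                       (f : Hom a X Y) (g : Hom b X′ Y′) (h : Hom c X″ Y″) →
                       tensor t (tensor s f g) h ≅ tensor v f (tensor u g h)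
    tensor-id        : ∀ {X Y} (s : 0# ⊕ 0# ≡ just 0#) →
                       tensor s (idₘ X) (idₘ Y) ≡ idₘ (X ⊗ Y)
    interchange      : ∀ {a b c X Y Z X′ Y′ Z′} (s : a ⊕ b ≡ just c)
                       (f : Hom a X Y) (h : Hom a Y Z) (g : Hom b X′ Y′) (k : Hom b Y′ Z′) →
                       tensor s f g ⨾ tensor s h k ≡ tensor s (f ⨾ h) (g ⨾ k)

record GradedFunctor {e} {E : PCM e} {o ℓ} (C D : GradedMonoidal E o ℓ) :
                     Set (e ⊔ o ⊔ ℓ) where
  private
    module E = PCM E
    module C = GradedMonoidal C
    module D = GradedMonoidal D
  open E using (_⊕_; _≤_)
  field
    F₀      : C.Obj → D.Obj
    isHom   : IsMonoidHom C.monoid D.monoid F₀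
    functor : ∀ a → FunctorOver (C.cat a) (D.cat a) F₀

  map : ∀ {a X Y} → C.Hom a X Y → D.Hom a (F₀ X) (F₀ Y)
  map {a} = FunctorOver.map (functor a)

  field
    map-tensor  : ∀ {a b c X Y X′ Y′} (s : a ⊕ b ≡ just c)
                  (g : C.Hom a X Y) (h : C.Hom b X′ Y′) →
                  map (C.tensor s g h) ≅ D.tensor s (map g) (map h)
    map-regrade : ∀ {a b X Y} (p : a ≤ b) (g : C.Hom a X Y) →
                  map (g C.↑ p) ≡ map g D.↑ p

idGraded : ∀ {e} {E : PCM e} {o ℓ} {C : GradedMonoidal E o ℓ} → GradedFunctor C C
idGraded {C = C} = record
  { F₀          = id
  ; isHom       = isMonoidHom-id (GradedMonoidal.monoid C)
  ; functor     = λ a → idOver (GradedMonoidal.cat C a)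
  ; map-tensor  = λ _ _ _ → refl
  ; map-regrade = λ _ _ → refl
  }

_∘Graded_ : ∀ {e} {E : PCM e} {o ℓ} {A B C : GradedMonoidal E o ℓ} →
            GradedFunctor B C → GradedFunctor A B → GradedFunctor A C
_∘Graded_ {A = A} {B} {C} G F = record
  { F₀          = G.F₀ ∘ F.F₀
  ; isHom       = isMonoidHom-∘ A.monoid B.monoid C.monoid G.isHom F.isHom
  ; functor     = λ a → G.functor a ∘Over F.functor a
  ; map-tensor  = λ {_} {_} {c} s g h →
      ≅.trans (FunctorOver.map-≅ (G.functor c) (homo _ _) (homo _ _) (F.map-tensor s g h))
              (G.map-tensor s (F.map g) (F.map h))
  ; map-regrade = λ p g → ≡.trans (cong G.map (F.map-regrade p g)) (G.map-regrade p (F.map g))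
  }
  where
    module A = GradedMonoidal A
    module B = GradedMonoidal B
    module C = GradedMonoidal C
    module F = GradedFunctor F
    module G = GradedFunctor G
    open MonoidMorphisms.IsMonoidHomomorphism F.isHom using (homo)

------------------------------------------------------------------------
-- Strict monoidal and premonoidal categories

record StrictMonoidal {o} (M : ObjMonoid o) (ℓ : Level) : Set (o ⊔ suc ℓ) where
  open ObjMonoid M
  field
    cat : CategoryOn Obj ℓ
  open CategoryOn cat public
  infixr 7 _⊗₁_
  field
    _⊗₁_ : ∀ {X Y X′ Y′} → Hom X Y → Hom X′ Y′ → Hom (X ⊗ X′) (Y ⊗ Y′)

    ⊗₁-id   : ∀ {X Y} → idn {X} ⊗₁ idn {Y} ≡ idn
    ⊗₁-comp : ∀ {X Y Z X′ Y′ Z′}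
              (f : Hom X Y) (h : Hom Y Z) (g : Hom X′ Y′) (k : Hom Y′ Z′) →
              (f ⊗₁ g) ⨾ (h ⊗₁ k) ≡ (f ⨾ h) ⊗₁ (g ⨾ k)

    ⊗₁-identityˡ : ∀ {X Y} (f : Hom X Y) → idn {I} ⊗₁ f ≅ f
    ⊗₁-identityʳ : ∀ {X Y} (f : Hom X Y) → f ⊗₁ idn {I} ≅ f
    ⊗₁-assoc     : ∀ {X Y X′ Y′ X″ Y″}
                   (f : Hom X Y) (g : Hom X′ Y′) (h : Hom X″ Y″) →
                   (f ⊗₁ g) ⊗₁ h ≅ f ⊗₁ (g ⊗₁ h)

record StrictPremonoidal {o} (M : ObjMonoid o) (ℓ : Level) : Set (o ⊔ suc ℓ) where
  open ObjMonoid M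
  field
    cat          : CategoryOn Obj ℓ
    leftWhisker  : ∀ A → FunctorOver cat cat (λ B → A ⊗ B)
    rightWhisker : ∀ A → FunctorOver cat cat (λ B → B ⊗ A)
  open CategoryOn cat public

  infix 7 _⋉_ _⋊_
  _⋉_ : ∀ A {X Y} → Hom X Y → Hom (A ⊗ X) (A ⊗ Y)
  A ⋉ f = FunctorOver.map (leftWhisker A) f

  _⋊_ : ∀ {X Y} → Hom X Y → ∀ A → Hom (X ⊗ A) (Y ⊗ A)
  f ⋊ A = FunctorOver.map (rightWhisker A) f

  field
    ⋉-⋊  : ∀ A B {X Y} (f : Hom X Y) → (A ⋉ f) ⋊ B ≅ A ⋉ (f ⋊ B)
    ⊗-⋉  : ∀ A B {X Y} (f : Hom X Y) → (A ⊗ B) ⋉ f ≅ A ⋉ (B ⋉ f)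
    ⋊-⊗  : ∀ A B {X Y} (f : Hom X Y) → f ⋊ (A ⊗ B) ≅ (f ⋊ A) ⋊ B
    I-⋉  : ∀ {X Y} (f : Hom X Y) → I ⋉ f ≅ f
    ⋊-I  : ∀ {X Y} (f : Hom X Y) → f ⋊ I ≅ f

  record Central {A B} (f : Hom A B) : Set (o ⊔ ℓ) where
    field
      centralʳ : ∀ {C D} (g : Hom C D) → (A ⋉ g) ⨾ (f ⋊ D) ≡ (f ⋊ C) ⨾ (B ⋉ g)
      centralˡ : ∀ {C D} (g : Hom C D) → (g ⋊ A) ⨾ (D ⋉ f) ≡ (C ⋉ f) ⨾ (g ⋊ B)

premonoidal : ∀ {o} {M : ObjMonoid o} {ℓ} → StrictMonoidal M ℓ → StrictPremonoidal M ℓ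
premonoidal V = record
  { cat          = cat
  ; leftWhisker  = λ A → record
      { map      = idn {A} ⊗₁_
      ; map-id   = ⊗₁-id
      ; map-comp = λ f g → ≡.sym (≡.trans (⊗₁-comp idn idn f g)
                                          (cong (_⊗₁ (f ⨾ g)) (identityˡ idn)))
      }
  ; rightWhisker = λ A → record
      { map      = _⊗₁ idn {A}
      ; map-id   = ⊗₁-id
      ; map-comp = λ f g → ≡.sym (≡.trans (⊗₁-comp f g idn idn)
                                          (cong ((f ⨾ g) ⊗₁_) (identityˡ idn)))
      }
  ; ⋉-⋊  = λ A B f → ⊗₁-assoc idn f idn
  ; ⊗-⋉  = λ A B f → ≅.trans (≡-to-≅ (cong (_⊗₁ f) (≡.sym ⊗₁-id))) (⊗₁-assoc idn idn f)
  ; ⋊-⊗  = λ A B f → ≅.trans (≡-to-≅ (cong (f ⊗₁_) (≡.sym ⊗₁-id)))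
                             (≅.sym (⊗₁-assoc f idn idn))
  ; I-⋉  = ⊗₁-identityˡ
  ; ⋊-I  = ⊗₁-identityʳ
  }
  where open StrictMonoidal V

record StrictMonoidalFunctor
         {o o′ ℓ ℓ′} {M : ObjMonoid o} {N : ObjMonoid o′}
         (V : StrictMonoidal M ℓ) (W : StrictMonoidal N ℓ′)
         (F₀ : ObjMonoid.Obj M → ObjMonoid.Obj N) : Set (o ⊔ o′ ⊔ ℓ ⊔ ℓ′) where
  private
    module V = StrictMonoidal V
    module W = StrictMonoidal W
  field
    isHom   : IsMonoidHom M N F₀
    functor : FunctorOver V.cat W.cat F₀
  open FunctorOver functor public
  field
    map-⊗₁ : ∀ {X Y X′ Y′} (f : V.Hom X Y) (g : V.Hom X′ Y′) →
             map (f V.⊗₁ g) ≅ map f W.⊗₁ map g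

record StrictPremonoidalFunctor
         {o o′ ℓ ℓ′} {M : ObjMonoid o} {N : ObjMonoid o′}
         (C : StrictPremonoidal M ℓ) (D : StrictPremonoidal N ℓ′)
         (F₀ : ObjMonoid.Obj M → ObjMonoid.Obj N) : Set (o ⊔ o′ ⊔ ℓ ⊔ ℓ′) where
  private
    module C = StrictPremonoidal C
    module D = StrictPremonoidal D
  field
    isHom   : IsMonoidHom M N F₀
    functor : FunctorOver C.cat D.cat F₀
  open FunctorOver functor public
  field
    map-⋉ : ∀ A {X Y} (f : C.Hom X Y) → map (A C.⋉ f) ≅ F₀ A D.⋉ map f
    map-⋊ : ∀ A {X Y} (f : C.Hom X Y) → map (f C.⋊ A) ≅ map f D.⋊ F₀ A

------------------------------------------------------------------------
-- Effectful categories

-- Since η is the identity on objects and a monoid homomorphism there, V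
-- and C have the same monoid of objects.
record Effectful (o ℓ : Level) : Set (suc (o ⊔ ℓ)) where
  field
    monoid : ObjMonoid o
    V      : StrictMonoidal monoid ℓ
    C      : StrictPremonoidal monoid ℓ
    η      : StrictPremonoidalFunctor (premonoidal V) C id

  open ObjMonoid monoid public
  module V = StrictMonoidal V
  module C = StrictPremonoidal C
  module η = StrictPremonoidalFunctor η

  field
    η-central : ∀ {X Y} (f : V.Hom X Y) → C.Central (η.map f)

-- F₁ ∘ η = η′ ∘ F₀ forces the two functors to agree on objects, as η and
-- η′ are the identity there; onObj is their common action.
record EffectfulFunctor {o ℓ} (A B : Effectful o ℓ) : Set (o ⊔ ℓ) where
  private
    module A = Effectful A
    module B = Effectful B
  field
    onObj : A.Obj → B.Obj
    F₀    : StrictMonoidalFunctor A.V B.V onObj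
    F₁    : StrictPremonoidalFunctor A.C B.C onObj

  module F₀ = StrictMonoidalFunctor F₀
  module F₁ = StrictPremonoidalFunctor F₁

  field
    F₁∘η≡η∘F₀ : ∀ {X Y} (f : A.V.Hom X Y) → F₁.map (A.η.map f) ≡ B.η.map (F₀.map f)

idEffectful : ∀ {o ℓ} {A : Effectful o ℓ} → EffectfulFunctor A A
idEffectful {A = A} = record
  { onObj     = id
  ; F₀        = record
      { isHom   = isMonoidHom-id A.monoid
      ; functor = idOver A.V.cat
      ; map-⊗₁  = λ _ _ → refl
      }
  ; F₁        = record
      { isHom   = isMonoidHom-id A.monoid
      ; functor = idOver A.C.cat
      ; map-⋉   = λ _ _ → refl
      ; map-⋊   = λ _ _ → refl
      }
  ; F₁∘η≡η∘F₀ = λ _ → refl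
  }
  where module A = Effectful A

_∘Effectful_ : ∀ {o ℓ} {A B C : Effectful o ℓ} →
               EffectfulFunctor B C → EffectfulFunctor A B → EffectfulFunctor A C
_∘Effectful_ {A = A} {B} {C} G F = record
  { onObj     = G.onObj ∘ F.onObj
  ; F₀        = record
      { isHom   = isMonoidHom-∘ A.monoid B.monoid C.monoid G.F₀.isHom F.F₀.isHom
      ; functor = G.F₀.functor ∘Over F.F₀.functor
      ; map-⊗₁  = λ f g →
          ≅.trans (G.F₀.map-≅ (homo₀ _ _) (homo₀ _ _) (F.F₀.map-⊗₁ f g)) (G.F₀.map-⊗₁ _ _)
      }
  ; F₁        = record
      { isHom   = isMonoidHom-∘ A.monoid B.monoid C.monoid G.F₁.isHom F.F₁.isHom
      ; functor = G.F₁.functor ∘Over F.F₁.functor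
      ; map-⋉   = λ X f →
          ≅.trans (G.F₁.map-≅ (homo₁ _ _) (homo₁ _ _) (F.F₁.map-⋉ X f)) (G.F₁.map-⋉ _ _)
      ; map-⋊   = λ X f →
          ≅.trans (G.F₁.map-≅ (homo₁ _ _) (homo₁ _ _) (F.F₁.map-⋊ X f)) (G.F₁.map-⋊ _ _)
      }
  ; F₁∘η≡η∘F₀ = λ f → ≡.trans (cong G.F₁.map (F.F₁∘η≡η∘F₀ f)) (G.F₁∘η≡η∘F₀ (F.F₀.map f))
  }
  where
    module A = Effectful A
    module B = Effectful B
    module C = Effectful C
    module F = EffectfulFunctor F
    module G = EffectfulFunctor G
    open MonoidMorphisms.IsMonoidHomomorphism F.F₀.isHom using () renaming (homo to homo₀)
    open MonoidMorphisms.IsMonoidHomomorphism F.F₁.isHom using () renaming (homo to homo₁)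

------------------------------------------------------------------------
-- The categories E-GradMon and Eff

-- Function extensionality is needed only to compare the proofs of the
-- laws contained in morphisms: morphisms with the same action on objects
-- and on hom-sets are equal.
module _ (ext : FunExt) where

  private
    iext : ∀ {a b} {A : Set a} {B : A → Set b} {f g : {x : A} → B x} →
           (∀ {x} → f {x} ≡ g {x}) → (λ {x} → f {x}) ≡ (λ {x} → g {x})
    iext = implicit-extensionality ext

    isMonoidHom-irrelevant :
      ∀ {o o′} {M : ObjMonoid o} {N : ObjMonoid o′}
        {f : ObjMonoid.Obj M → ObjMonoid.Obj N} →
      (p q : IsMonoidHom M N f) → p ≡ q
    isMonoidHom-irrelevant {M = M} {N} {f} p q =
      lemma (iext (iext (ext λ _ → uip _ _))) (ext λ _ → ext λ _ → uip _ _) (uip _ _)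
      where
        module P = MonoidMorphisms.IsMonoidHomomorphism p
        module Q = MonoidMorphisms.IsMonoidHomomorphism q
        mk : (∀ {x y} → x ≡ y → f x ≡ f y) → _ → _ → IsMonoidHom M N f
        mk c h e = record
          { isMagmaHomomorphism = record
              { isRelHomomorphism = record { cong = c } ; homo = h }
          ; ε-homo = e
          }
        lemma : (λ {x} {y} → P.⟦⟧-cong {x} {y}) ≡ Q.⟦⟧-cong →
                P.homo ≡ Q.homo → P.ε-homo ≡ Q.ε-homo → p ≡ q
        lemma refl refl refl = refl

  FunctorOver-≡ :
    ∀ {o o′ ℓ ℓ′} {Obj : Set o} {Obj′ : Set o′}
      {C : CategoryOn Obj ℓ} {D : CategoryOn Obj′ ℓ′} {h : Obj → Obj′}
      {F G : FunctorOver C D h} →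
    (∀ {X Y} (f : CategoryOn.Hom C X Y) → FunctorOver.map F f ≡ FunctorOver.map G f) →
    F ≡ G
  FunctorOver-≡ {C = C} {D} {h} {F} {G} eq =
    map-≡ F G (iext (iext (ext eq)))
    where
      module C = CategoryOn C
      module D = CategoryOn D
      module _ {m : ∀ {X Y} → C.Hom X Y → D.Hom (h X) (h Y)} where
        laws-≡ : {i i′ : ∀ {X} → m (C.idn {X}) ≡ D.idn}
                 {c c′ : ∀ {X Y Z} (f : C.Hom X Y) (g : C.Hom Y Z) →
                         m (f C.⨾ g) ≡ m f D.⨾ m g} →
                 (λ {X} → i {X}) ≡ i′ → (λ {X Y Z} → c {X} {Y} {Z}) ≡ c′ →
                 _≡_ {A = FunctorOver C D h}
                     (record { map = m ; map-id = i  ; map-comp = c })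
                     (record { map = m ; map-id = i′ ; map-comp = c′ })
        laws-≡ refl refl = refl
      map-≡ : (F G : FunctorOver C D h) →
              (λ {X} {Y} → FunctorOver.map F {X} {Y}) ≡ FunctorOver.map G → F ≡ G
      map-≡ record { map-id = i ; map-comp = c } record { map-id = i′ ; map-comp = c′ } refl =
        laws-≡ (iext (uip _ _)) (iext (iext (iext (ext λ _ → ext λ _ → uip _ _))))

  GradedFunctor-≡ :
    ∀ {e} {E : PCM e} {o ℓ} {C D : GradedMonoidal E o ℓ} {F G : GradedFunctor C D} →
    GradedFunctor.F₀ F ≡ GradedFunctor.F₀ G →
    GradedFunctor.functor F ≅ GradedFunctor.functor G →
    F ≡ G
  GradedFunctor-≡ {E = E} {C = C} {D} {F} {G} = functor-≡ F G
    where
      open PCM E using (_⊕_; _≤_) renaming (Carrier to |E|)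
      module C = GradedMonoidal C
      module D = GradedMonoidal D
      module _ {h : C.Obj → D.Obj} {M : ∀ a → FunctorOver (C.cat a) (D.cat a) h} where
        map : ∀ {a X Y} → C.Hom a X Y → D.Hom a (h X) (h Y)
        map {a} = FunctorOver.map (M a)
        laws-≡ : {i i′ : IsMonoidHom C.monoid D.monoid h}
                 {t t′ : ∀ {a b c X Y X′ Y′} (s : a ⊕ b ≡ just c)
                         (g : C.Hom a X Y) (h : C.Hom b X′ Y′) →
                         map (C.tensor s g h) ≅ D.tensor s (map g) (map h)}
                 {r r′ : ∀ {a b X Y} (p : a ≤ b) (g : C.Hom a X Y) →
                         map (g C.↑ p) ≡ map g D.↑ p} →
                 i ≡ i′ →
                 (λ {a b c X Y X′ Y′} → t {a} {b} {c} {X} {Y} {X′} {Y′}) ≡ t′ →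
                 (λ {a b X Y} → r {a} {b} {X} {Y}) ≡ r′ →
                 _≡_ {A = GradedFunctor C D}
                     (record { isHom = i  ; functor = M ; map-tensor = t  ; map-regrade = r })
                     (record { isHom = i′ ; functor = M ; map-tensor = t′ ; map-regrade = r′ })
        laws-≡ refl refl refl = refl
      functor-≡ : (F G : GradedFunctor C D) → GradedFunctor.F₀ F ≡ GradedFunctor.F₀ G →
                  GradedFunctor.functor F ≅ GradedFunctor.functor G → F ≡ G
      functor-≡ record { isHom = i } record { isHom = i′ } refl refl =
        laws-≡ (isMonoidHom-irrelevant {M = C.monoid} {N = D.monoid} i i′)
               (iext (iext (iext (iext (iext (iext (iext
                 (ext λ _ → ext λ _ → ext λ _ → ≅-irrelevant _ _))))))))
               (iext (iext (iext (iext (ext λ _ → ext λ _ → uip _ _)))))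

  StrictMonoidalFunctor-≡ :
    ∀ {o o′ ℓ ℓ′} {M : ObjMonoid o} {N : ObjMonoid o′}
      {V : StrictMonoidal M ℓ} {W : StrictMonoidal N ℓ′}
      {h : ObjMonoid.Obj M → ObjMonoid.Obj N} {F G : StrictMonoidalFunctor V W h} →
    StrictMonoidalFunctor.functor F ≡ StrictMonoidalFunctor.functor G → F ≡ G
  StrictMonoidalFunctor-≡ {M = M} {N} {V} {W} {h} {F} {G} = functor-≡ F G
    where
      module V = StrictMonoidal V
      module W = StrictMonoidal W
      module _ {K : FunctorOver V.cat W.cat h} where
        open FunctorOver K using (map)
        laws-≡ : {i i′ : IsMonoidHom M N h}
                 {t t′ : ∀ {X Y X′ Y′} (f : V.Hom X Y) (g : V.Hom X′ Y′) →
                         map (f V.⊗₁ g) ≅ map f W.⊗₁ map g} →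
                 i ≡ i′ → (λ {X Y X′ Y′} → t {X} {Y} {X′} {Y′}) ≡ t′ →
                 _≡_ {A = StrictMonoidalFunctor V W h}
                     (record { isHom = i  ; functor = K ; map-⊗₁ = t })
                     (record { isHom = i′ ; functor = K ; map-⊗₁ = t′ })
        laws-≡ refl refl = refl
      functor-≡ : (F G : StrictMonoidalFunctor V W h) →
                  StrictMonoidalFunctor.functor F ≡ StrictMonoidalFunctor.functor G → F ≡ G
      functor-≡ record { isHom = i } record { isHom = i′ } refl =
        laws-≡ (isMonoidHom-irrelevant {M = M} {N = N} i i′)
               (iext (iext (iext (iext (ext λ _ → ext λ _ → ≅-irrelevant _ _)))))

  StrictPremonoidalFunctor-≡ :
    ∀ {o o′ ℓ ℓ′} {M : ObjMonoid o} {N : ObjMonoid o′}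
      {C : StrictPremonoidal M ℓ} {D : StrictPremonoidal N ℓ′}
      {h : ObjMonoid.Obj M → ObjMonoid.Obj N} {F G : StrictPremonoidalFunctor C D h} →
    StrictPremonoidalFunctor.functor F ≡ StrictPremonoidalFunctor.functor G → F ≡ G
  StrictPremonoidalFunctor-≡ {M = M} {N} {C} {D} {h} {F} {G} = functor-≡ F G
    where
      module C = StrictPremonoidal C
      module D = StrictPremonoidal D
      module _ {K : FunctorOver C.cat D.cat h} where
        open FunctorOver K using (map)
        laws-≡ : {i i′ : IsMonoidHom M N h}
                 {l l′ : ∀ A {X Y} (f : C.Hom X Y) → map (A C.⋉ f) ≅ h A D.⋉ map f}
                 {r r′ : ∀ A {X Y} (f : C.Hom X Y) → map (f C.⋊ A) ≅ map f D.⋊ h A} →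
                 i ≡ i′ → (λ A {X Y} → l A {X} {Y}) ≡ l′ → (λ A {X Y} → r A {X} {Y}) ≡ r′ →
                 _≡_ {A = StrictPremonoidalFunctor C D h}
                     (record { isHom = i  ; functor = K ; map-⋉ = l  ; map-⋊ = r })
                     (record { isHom = i′ ; functor = K ; map-⋉ = l′ ; map-⋊ = r′ })
        laws-≡ refl refl refl = refl
      functor-≡ : (F G : StrictPremonoidalFunctor C D h) →
                  StrictPremonoidalFunctor.functor F ≡ StrictPremonoidalFunctor.functor G →
                  F ≡ G
      functor-≡ record { isHom = i } record { isHom = i′ } refl =
        laws-≡ (isMonoidHom-irrelevant {M = M} {N = N} i i′)
               (ext λ _ → iext (iext (ext λ _ → ≅-irrelevant _ _)))
               (ext λ _ → iext (iext (ext λ _ → ≅-irrelevant _ _)))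

  EffectfulFunctor-≡ :
    ∀ {o ℓ} {A B : Effectful o ℓ} {F G : EffectfulFunctor A B} →
    EffectfulFunctor.onObj F ≡ EffectfulFunctor.onObj G →
    EffectfulFunctor.F₀ F ≅ EffectfulFunctor.F₀ G →
    EffectfulFunctor.F₁ F ≅ EffectfulFunctor.F₁ G →
    F ≡ G
  EffectfulFunctor-≡ {A = A} {B} {F} {G} = functors-≡ F G
    where
      module A = Effectful A
      module B = Effectful B
      module _ {h : A.Obj → B.Obj} {F₀ : StrictMonoidalFunctor A.V B.V h}
               {F₁ : StrictPremonoidalFunctor A.C B.C h} where
        module F₀ = StrictMonoidalFunctor F₀
        module F₁ = StrictPremonoidalFunctor F₁
        laws-≡ : {c c′ : ∀ {X Y} (f : A.V.Hom X Y) →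
                         F₁.map (A.η.map f) ≡ B.η.map (F₀.map f)} →
                 (λ {X Y} → c {X} {Y}) ≡ c′ →
                 _≡_ {A = EffectfulFunctor A B}
                     (record { F₀ = F₀ ; F₁ = F₁ ; F₁∘η≡η∘F₀ = c })
                     (record { F₀ = F₀ ; F₁ = F₁ ; F₁∘η≡η∘F₀ = c′ })
        laws-≡ refl = refl
      functors-≡ : (F G : EffectfulFunctor A B) →
                   EffectfulFunctor.onObj F ≡ EffectfulFunctor.onObj G →
                   EffectfulFunctor.F₀ F ≅ EffectfulFunctor.F₀ G →
                   EffectfulFunctor.F₁ F ≅ EffectfulFunctor.F₁ G → F ≡ G
      functors-≡ record {} record {} refl refl refl =
        laws-≡ (iext (iext (ext λ _ → uip _ _)))

  GradMon : ∀ {e} (E : PCM e) (o ℓ : Level) → Category (e ⊔ suc (o ⊔ ℓ)) (e ⊔ o ⊔ ℓ)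
  GradMon E o ℓ = record
    { Obj        = GradedMonoidal E o ℓ
    ; categoryOn = record
        { Hom       = GradedFunctor
        ; idn       = idGraded
        ; _⨾_       = λ F G → G ∘Graded F
        ; identityˡ = λ _ → GradedFunctor-≡ refl (≡-to-≅ (ext λ _ → FunctorOver-≡ λ _ → refl))
        ; identityʳ = λ _ → GradedFunctor-≡ refl (≡-to-≅ (ext λ _ → FunctorOver-≡ λ _ → refl))
        ; assoc     = λ _ _ _ →
            GradedFunctor-≡ refl (≡-to-≅ (ext λ _ → FunctorOver-≡ λ _ → refl))
        }
    }

  Eff : (o ℓ : Level) → Category (suc (o ⊔ ℓ)) (o ⊔ ℓ)
  Eff o ℓ = record
    { Obj        = Effectful o ℓ
    ; categoryOn = record
        { Hom       = EffectfulFunctor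
        ; idn       = idEffectful
        ; _⨾_       = λ F G → G ∘Effectful F
        ; identityˡ = λ _ → EffectfulFunctor-≡ refl
            (≡-to-≅ (StrictMonoidalFunctor-≡ (FunctorOver-≡ λ _ → refl)))
            (≡-to-≅ (StrictPremonoidalFunctor-≡ (FunctorOver-≡ λ _ → refl)))
        ; identityʳ = λ _ → EffectfulFunctor-≡ refl
            (≡-to-≅ (StrictMonoidalFunctor-≡ (FunctorOver-≡ λ _ → refl)))
            (≡-to-≅ (StrictPremonoidalFunctor-≡ (FunctorOver-≡ λ _ → refl)))
        ; assoc     = λ _ _ _ → EffectfulFunctor-≡ refl
            (≡-to-≅ (StrictMonoidalFunctor-≡ (FunctorOver-≡ λ _ → refl)))
            (≡-to-≅ (StrictPremonoidalFunctor-≡ (FunctorOver-≡ λ _ → refl)))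
        }
    }

{-# OPTIONS --safe #-}
module Submission where

-- A 𝟚-graded monoidal category is an effectful category in which C₀ is the
-- pure part, C₁ the effectful part, η is regrading, and the whiskerings are
-- tensors with identities of C₀.  Conversely, tensors involving a pure and an
-- effectful morphism are u ⊠ v = (u ⋊ X′) ⨾ (Y ⋉ v), with the pure one first
-- sent along η.  The product ⊠ is associative in any premonoidal category,
-- and satisfies interchange as soon as the two middle factors commute, which
-- centrality of the values of η provides.

open import Defs
open import Level using (Level)
open import Data.Empty using (⊥-elim)
open import Data.Fin.Base using (Fin)
open import Data.Fin.Patterns using (0F; 1F)
open import Data.Maybe.Base using (just)
open import Data.Product.Base using (_,_)
open import Function.Base using (id)
open import Algebra.Morphism.Structures using (module MonoidMorphisms)
open import Axiom.Extensionality.Propositional using (implicit-extensionality)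
open import Axiom.UniquenessOfIdentityProofs.WithK using (uip)
open import Relation.Nullary.Negation.Core using (¬_)
open import Relation.Binary.PropositionalEquality as ≡ using (_≡_; refl; cong; cong₂)
open import Relation.Binary.HeterogeneousEquality as ≅
  using (_≅_; refl; ≅-to-≡; ≡-to-≅; ≅-irrelevant; module ≅-Reasoning)

-- Heterogeneous function extensionality.

-- Pointwise heterogeneous equality already forces `B x ≡ B′ x`. By `ext` the two codomain families
-- are then equal, and once they are identified the claim is ordinary extensionality.
≅-ext : FunExt → ∀ {a b} {A : Set a} {B B′ : A → Set b} {f : ∀ x → B x} {g : ∀ x → B′ x} →
        (∀ x → f x ≅ g x) → f ≅ g
≅-ext ext {f = f} {g} eq = same-codomain (ext λ x → ≅.≅-to-type-≡ (eq x)) f g eq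
  where
  same-codomain : ∀ {a b} {A : Set a} {B B′ : A → Set b} → B ≡ B′ →
                  (f : ∀ x → B x) (g : ∀ x → B′ x) → (∀ x → f x ≅ g x) → f ≅ g
  same-codomain refl f g eq = ≡-to-≅ (ext λ x → ≅-to-≡ (eq x))

≅-iext : FunExt → ∀ {a b} {A : Set a} {B B′ : A → Set b} {f : ∀ {x} → B x} {g : ∀ {x} → B′ x} →
         (∀ x → f {x} ≅ g {x}) → (λ {x} → f {x}) ≅ (λ {x} → g {x})
≅-iext ext {f = f} {g} eq = same-codomain (ext λ x → ≅.≅-to-type-≡ (eq x)) f g eq
  where
  same-codomain : ∀ {a b} {A : Set a} {B B′ : A → Set b} → B ≡ B′ →
                  (f : ∀ {x} → B x) (g : ∀ {x} → B′ x) → (∀ x → f {x} ≅ g {x}) →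
                  (λ {x} → f {x}) ≅ (λ {x} → g {x})
  same-codomain refl f g eq = ≡-to-≅ (implicit-extensionality ext λ {x} → ≅-to-≡ (eq x))

-- Equality of structures from equality of their data.

module _ (ext : FunExt) where

  iext : ∀ {a b} {A : Set a} {B : A → Set b} {f g : {x : A} → B x} →
         (∀ {x} → f {x} ≡ g {x}) → (λ {x} → f {x}) ≡ (λ {x} → g {x})
  iext = implicit-extensionality ext

  -- The images of a morphism have endpoints that agree only propositionally, hence `≅` in the
  -- second hypothesis. It becomes `≡` once the actions on objects are identified.
  Functor-≡ : ∀ {o ℓ o′ ℓ′} {C : Category o ℓ} {D : Category o′ ℓ′} {F G : Functor C D} →
              (∀ X → Functor.F₀ F X ≡ Functor.F₀ G X) →
              (∀ {X Y} (f : Category.Hom C X Y) → Functor.map F f ≅ Functor.map G f) →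
              F ≡ G
  Functor-≡ {C = C} {D} {F} {G} eq₀ = same-objects F G (ext eq₀)
    where
    same-objects : (F G : Functor C D) → Functor.F₀ F ≡ Functor.F₀ G →
                   (∀ {X Y} (f : Category.Hom C X Y) → Functor.map F f ≅ Functor.map G f) →
                   F ≡ G
    same-objects record { F₀ = F₀ } record {} refl eq =
      cong (λ H → record { F₀ = F₀ ; functorOver = H }) (FunctorOver-≡ ext λ f → ≅-to-≡ (eq f))

  -- Every law is an equation, so under axiom K and `ext` any two proofs of it agree and only the
  -- data count. The data are listed in order of dependency: matching one equality on `refl` brings
  -- the next two components into a common type.
  GradedMonoidal-≡ :
    ∀ {e} {E : PCM e} {o ℓ} {G H : GradedMonoidal E o ℓ} →
    GradedMonoidal.monoid G ≡ GradedMonoidal.monoid H →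
    GradedMonoidal.cat G ≅ GradedMonoidal.cat H →
    (λ {a b} → GradedMonoidal.regrade G {a} {b}) ≅ (λ {a b} → GradedMonoidal.regrade H {a} {b}) →
    (λ {a b c} → GradedMonoidal.tensor G {a} {b} {c}) ≅
    (λ {a b c} → GradedMonoidal.tensor H {a} {b} {c}) →
    G ≡ H
  GradedMonoidal-≡ {E = E} {o} {ℓ} {G} {H} = data-≡ G H
    where
    open PCM E using (_⊕_; 0#; _≤_) renaming (Carrier to |E|)

    module _ {monoid : ObjMonoid o} {cat : |E| → CategoryOn (ObjMonoid.Obj monoid) ℓ}
             {regrade : ∀ {a b} → a ≤ b → FunctorOver (cat a) (cat b) id} where
      open ObjMonoid monoid

      Hom : |E| → Obj → Obj → Set ℓ
      Hom a = CategoryOn.Hom (cat a)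

      infixl 5 _⨾_
      _⨾_ : ∀ {a X Y Z} → Hom a X Y → Hom a Y Z → Hom a X Z
      _⨾_ {a} = CategoryOn._⨾_ (cat a)

      idₘ : ∀ X → Hom 0# X X
      idₘ X = CategoryOn.idn (cat 0#)

      _↑_ : ∀ {a b X Y} → Hom a X Y → a ≤ b → Hom b X Y
      f ↑ p = FunctorOver.map (regrade p) f

      module _ {tensor : ∀ {a b c} → a ⊕ b ≡ just c → ∀ {X Y X′ Y′} →
                         Hom a X Y → Hom b X′ Y′ → Hom c (X ⊗ X′) (Y ⊗ Y′)} where

        -- With the data fixed, both families of laws are variables, so that the equalities between
        -- them can be matched on `refl`.
        laws-≡ :
          {rr rr′ : ∀ {a X Y} (p : a ≤ a) (f : Hom a X Y) → f ↑ p ≡ f}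
          {rt rt′ : ∀ {a b c X Y} (p : a ≤ b) (q : b ≤ c) (r : a ≤ c) (f : Hom a X Y) →
                    (f ↑ p) ↑ q ≡ f ↑ r}
          {rx rx′ : ∀ {a b c d ab cd X Y X′ Y′} (p : a ≤ c) (q : b ≤ d)
                    (s : a ⊕ b ≡ just ab) (t : c ⊕ d ≡ just cd) (r : ab ≤ cd)
                    (f : Hom a X Y) (g : Hom b X′ Y′) →
                    tensor s f g ↑ r ≡ tensor t (f ↑ p) (g ↑ q)}
          {tʳ tʳ′ : ∀ {a X Y} (s : a ⊕ 0# ≡ just a) (f : Hom a X Y) → tensor s f (idₘ I) ≅ f}
          {tˡ tˡ′ : ∀ {a X Y} (s : 0# ⊕ a ≡ just a) (f : Hom a X Y) → tensor s (idₘ I) f ≅ f}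
          {ta ta′ : ∀ {a b c ab bc abc X Y X′ Y′ X″ Y″}
                    (s : a ⊕ b ≡ just ab) (t : ab ⊕ c ≡ just abc)
                    (u : b ⊕ c ≡ just bc) (v : a ⊕ bc ≡ just abc)
                    (f : Hom a X Y) (g : Hom b X′ Y′) (h : Hom c X″ Y″) →
                    tensor t (tensor s f g) h ≅ tensor v f (tensor u g h)}
          {ti ti′ : ∀ {X Y} (s : 0# ⊕ 0# ≡ just 0#) → tensor s (idₘ X) (idₘ Y) ≡ idₘ (X ⊗ Y)}
          {ic ic′ : ∀ {a b c X Y Z X′ Y′ Z′} (s : a ⊕ b ≡ just c)
                    (f : Hom a X Y) (h : Hom a Y Z) (g : Hom b X′ Y′) (k : Hom b Y′ Z′) →
                    tensor s f g ⨾ tensor s h k ≡ tensor s (f ⨾ h) (g ⨾ k)} →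
          (λ {a X Y} → rr {a} {X} {Y}) ≡ rr′ →
          (λ {a b c X Y} → rt {a} {b} {c} {X} {Y}) ≡ rt′ →
          (λ {a b c d ab cd X Y X′ Y′} → rx {a} {b} {c} {d} {ab} {cd} {X} {Y} {X′} {Y′}) ≡ rx′ →
          (λ {a X Y} → tʳ {a} {X} {Y}) ≡ tʳ′ →
          (λ {a X Y} → tˡ {a} {X} {Y}) ≡ tˡ′ →
          (λ {a b c ab bc abc X Y X′ Y′ X″ Y″} →
             ta {a} {b} {c} {ab} {bc} {abc} {X} {Y} {X′} {Y′} {X″} {Y″}) ≡ ta′ →
          (λ {X Y} → ti {X} {Y}) ≡ ti′ →
          (λ {a b c X Y Z X′ Y′ Z′} → ic {a} {b} {c} {X} {Y} {Z} {X′} {Y′} {Z′}) ≡ ic′ →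
          _≡_ {A = GradedMonoidal E o ℓ}
            (record { monoid = monoid ; cat = cat ; regrade = regrade ; tensor = tensor
                    ; regrade-refl = rr ; regrade-trans = rt ; regrade-tensor = rx
                    ; tensor-identityʳ = tʳ ; tensor-identityˡ = tˡ ; tensor-assoc = ta
                    ; tensor-id = ti ; interchange = ic })
            (record { monoid = monoid ; cat = cat ; regrade = regrade ; tensor = tensor
                    ; regrade-refl = rr′ ; regrade-trans = rt′ ; regrade-tensor = rx′
                    ; tensor-identityʳ = tʳ′ ; tensor-identityˡ = tˡ′ ; tensor-assoc = ta′
                    ; tensor-id = ti′ ; interchange = ic′ })
        laws-≡ refl refl refl refl refl refl refl refl = refl

    data-≡ : (G H : GradedMonoidal E o ℓ) →
             GradedMonoidal.monoid G ≡ GradedMonoidal.monoid H →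
             GradedMonoidal.cat G ≅ GradedMonoidal.cat H →
             (λ {a b} → GradedMonoidal.regrade G {a} {b}) ≅
             (λ {a b} → GradedMonoidal.regrade H {a} {b}) →
             (λ {a b c} → GradedMonoidal.tensor G {a} {b} {c}) ≅
             (λ {a b c} → GradedMonoidal.tensor H {a} {b} {c}) →
             G ≡ H
    data-≡ record {} record {} refl refl refl refl = laws-≡
      (iext (iext (iext (ext λ _ → ext λ _ → uip _ _))))
      (iext (iext (iext (iext (iext (ext λ _ → ext λ _ → ext λ _ → ext λ _ → uip _ _))))))
      (iext (iext (iext (iext (iext (iext (iext (iext (iext (iext
        (ext λ _ → ext λ _ → ext λ _ → ext λ _ → ext λ _ → ext λ _ → ext λ _ → uip _ _)))))))))))
      (iext (iext (iext (ext λ _ → ext λ _ → ≅-irrelevant _ _))))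
      (iext (iext (iext (ext λ _ → ext λ _ → ≅-irrelevant _ _))))
      (iext (iext (iext (iext (iext (iext (iext (iext (iext (iext (iext (iext
        (ext λ _ → ext λ _ → ext λ _ → ext λ _ → ext λ _ → ext λ _ → ext λ _ →
          ≅-irrelevant _ _)))))))))))))
      (iext (iext (ext λ _ → uip _ _)))
      (iext (iext (iext (iext (iext (iext (iext (iext (iext
        (ext λ _ → ext λ _ → ext λ _ → ext λ _ → ext λ _ → uip _ _))))))))))

  StrictPremonoidal-≡ :
    ∀ {o ℓ} {M : ObjMonoid o} {P Q : StrictPremonoidal M ℓ} →
    StrictPremonoidal.cat P ≡ StrictPremonoidal.cat Q →
    StrictPremonoidal.leftWhisker P ≅ StrictPremonoidal.leftWhisker Q →
    StrictPremonoidal.rightWhisker P ≅ StrictPremonoidal.rightWhisker Q →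
    P ≡ Q
  StrictPremonoidal-≡ {ℓ = ℓ} {M} {P} {Q} = data-≡ P Q
    where
    open ObjMonoid M

    module _ {cat : CategoryOn Obj ℓ} {L : ∀ A → FunctorOver cat cat (A ⊗_)}
             {R : ∀ A → FunctorOver cat cat (_⊗ A)} where
      open CategoryOn cat using (Hom)

      infix 7 _⋉_ _⋊_
      _⋉_ : ∀ A {X Y} → Hom X Y → Hom (A ⊗ X) (A ⊗ Y)
      A ⋉ f = FunctorOver.map (L A) f

      _⋊_ : ∀ {X Y} → Hom X Y → ∀ A → Hom (X ⊗ A) (Y ⊗ A)
      f ⋊ A = FunctorOver.map (R A) f

      laws-≡ :
        {lr lr′ : ∀ A B {X Y} (f : Hom X Y) → (A ⋉ f) ⋊ B ≅ A ⋉ (f ⋊ B)}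
        {ll ll′ : ∀ A B {X Y} (f : Hom X Y) → (A ⊗ B) ⋉ f ≅ A ⋉ (B ⋉ f)}
        {rr rr′ : ∀ A B {X Y} (f : Hom X Y) → f ⋊ (A ⊗ B) ≅ (f ⋊ A) ⋊ B}
        {li li′ : ∀ {X Y} (f : Hom X Y) → I ⋉ f ≅ f}
        {ri ri′ : ∀ {X Y} (f : Hom X Y) → f ⋊ I ≅ f} →
        (λ A B {X Y} → lr A B {X} {Y}) ≡ lr′ →
        (λ A B {X Y} → ll A B {X} {Y}) ≡ ll′ →
        (λ A B {X Y} → rr A B {X} {Y}) ≡ rr′ →
        (λ {X Y} → li {X} {Y}) ≡ li′ →
        (λ {X Y} → ri {X} {Y}) ≡ ri′ →
        _≡_ {A = StrictPremonoidal M ℓ}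
          (record { cat = cat ; leftWhisker = L ; rightWhisker = R
                  ; ⋉-⋊ = lr ; ⊗-⋉ = ll ; ⋊-⊗ = rr ; I-⋉ = li ; ⋊-I = ri })
          (record { cat = cat ; leftWhisker = L ; rightWhisker = R
                  ; ⋉-⋊ = lr′ ; ⊗-⋉ = ll′ ; ⋊-⊗ = rr′ ; I-⋉ = li′ ; ⋊-I = ri′ })
      laws-≡ refl refl refl refl refl = refl

    data-≡ : (P Q : StrictPremonoidal M ℓ) →
             StrictPremonoidal.cat P ≡ StrictPremonoidal.cat Q →
             StrictPremonoidal.leftWhisker P ≅ StrictPremonoidal.leftWhisker Q →
             StrictPremonoidal.rightWhisker P ≅ StrictPremonoidal.rightWhisker Q →
             P ≡ Q
    data-≡ record {} record {} refl refl refl = laws-≡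
      (ext λ _ → ext λ _ → iext (iext (ext λ _ → ≅-irrelevant _ _)))
      (ext λ _ → ext λ _ → iext (iext (ext λ _ → ≅-irrelevant _ _)))
      (ext λ _ → ext λ _ → iext (iext (ext λ _ → ≅-irrelevant _ _)))
      (iext (iext (ext λ _ → ≅-irrelevant _ _)))
      (iext (iext (ext λ _ → ≅-irrelevant _ _)))

  Central-irrelevant : ∀ {o ℓ} {M : ObjMonoid o} {P : StrictPremonoidal M ℓ}
                       {A B} {f : StrictPremonoidal.Hom P A B}
                       (c d : StrictPremonoidal.Central P f) → c ≡ d
  Central-irrelevant {P = P} c d = lemma
    (iext (iext (ext λ _ → uip _ _))) (iext (iext (ext λ _ → uip _ _)))
    where
    open StrictPremonoidal P
    open Central
    lemma : (λ {X Y} → centralʳ c {X} {Y}) ≡ centralʳ d →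
            (λ {X Y} → centralˡ c {X} {Y}) ≡ centralˡ d → c ≡ d
    lemma refl refl = refl

  Effectful-≡ : ∀ {o ℓ} {A B : Effectful o ℓ} →
                Effectful.monoid A ≡ Effectful.monoid B →
                Effectful.V A ≅ Effectful.V B →
                Effectful.C A ≅ Effectful.C B →
                Effectful.η A ≅ Effectful.η B →
                A ≡ B
  Effectful-≡ {o} {ℓ} {A} {B} = data-≡ A B
    where
    module _ {monoid : ObjMonoid o} {V : StrictMonoidal monoid ℓ} {C : StrictPremonoidal monoid ℓ}
             {η : StrictPremonoidalFunctor (premonoidal V) C id} where
      laws-≡ : {c c′ : ∀ {X Y} (f : StrictMonoidal.Hom V X Y) →
                       StrictPremonoidal.Central C (StrictPremonoidalFunctor.map η f)} →
               (λ {X Y} → c {X} {Y}) ≡ c′ →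
               _≡_ {A = Effectful o ℓ}
                 (record { monoid = monoid ; V = V ; C = C ; η = η ; η-central = c })
                 (record { monoid = monoid ; V = V ; C = C ; η = η ; η-central = c′ })
      laws-≡ refl = refl

    data-≡ : (A B : Effectful o ℓ) →
             Effectful.monoid A ≡ Effectful.monoid B →
             Effectful.V A ≅ Effectful.V B →
             Effectful.C A ≅ Effectful.C B →
             Effectful.η A ≅ Effectful.η B →
             A ≡ B
    data-≡ record { C = C } record {} refl refl refl refl =
      laws-≡ (iext (iext (ext λ _ → Central-irrelevant {P = C} _ _)))

  -- Equality of functors between propositionally equal structures.

  -- A round trip returns a structure that is equal to the original but not definitionally so, and
  -- functors then have to be compared across two types. Identifying the structures first reduces
  -- this to functors of one type.
  StrictPremonoidalFunctor-≅ :
    ∀ {o o′ ℓ ℓ′} {M : ObjMonoid o} {N : ObjMonoid o′}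
      {P P′ : StrictPremonoidal M ℓ} {Q Q′ : StrictPremonoidal N ℓ′}
      {h : ObjMonoid.Obj M → ObjMonoid.Obj N}
      {F : StrictPremonoidalFunctor P Q h} {G : StrictPremonoidalFunctor P′ Q′ h} →
    P ≡ P′ → Q ≡ Q′ →
    StrictPremonoidalFunctor.functor F ≅ StrictPremonoidalFunctor.functor G → F ≅ G
  StrictPremonoidalFunctor-≅ refl refl eq =
    ≡-to-≅ (StrictPremonoidalFunctor-≡ ext (≅-to-≡ eq))

  EffectfulFunctor-≅ :
    ∀ {o ℓ} {A A′ B B′ : Effectful o ℓ} {F : EffectfulFunctor A B} {G : EffectfulFunctor A′ B′} →
    A ≡ A′ → B ≡ B′ →
    EffectfulFunctor.onObj F ≅ EffectfulFunctor.onObj G →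
    EffectfulFunctor.F₀ F ≅ EffectfulFunctor.F₀ G →
    EffectfulFunctor.F₁ F ≅ EffectfulFunctor.F₁ G →
    F ≅ G
  EffectfulFunctor-≅ refl refl eq eq₀ eq₁ =
    ≡-to-≅ (EffectfulFunctor-≡ ext (≅-to-≡ eq) eq₀ eq₁)

  GradedFunctor-≅ :
    ∀ {e} {E : PCM e} {o ℓ} {C C′ D D′ : GradedMonoidal E o ℓ}
      {F : GradedFunctor C D} {G : GradedFunctor C′ D′} →
    C ≡ C′ → D ≡ D′ →
    GradedFunctor.F₀ F ≅ GradedFunctor.F₀ G →
    GradedFunctor.functor F ≅ GradedFunctor.functor G →
    F ≅ G
  GradedFunctor-≅ refl refl eq₀ eq = ≡-to-≅ (GradedFunctor-≡ ext (≅-to-≡ eq₀) eq)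

-- The extension order of `𝟚`.

open PCM 𝟚 using (_⊕_; _≤_)

1≰0 : ¬ (1F ≤ 0F)
1≰0 (0F , ())
1≰0 (1F , ())

0≤1 : 0F ≤ 1F
0≤1 = PCM.0≤ 𝟚 1F

-- The sequential product in a premonoidal category.

module _ {o ℓ} {Obj : Set o} (C : CategoryOn Obj ℓ) where
  open CategoryOn C

  -- The equalities of objects are separate hypotheses because `f ≅ f′` equates only the hom-sets,
  -- from which the endpoints cannot be read off.
  ⨾-≅ : ∀ {X Y Z X′ Y′ Z′} {f : Hom X Y} {g : Hom Y Z} {f′ : Hom X′ Y′} {g′ : Hom Y′ Z′} →
        X ≡ X′ → Y ≡ Y′ → Z ≡ Z′ → f ≅ f′ → g ≅ g′ → f ⨾ g ≅ f′ ⨾ g′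
  ⨾-≅ refl refl refl refl refl = refl

module Sequential {o ℓ} {M : ObjMonoid o} (P : StrictPremonoidal M ℓ) where
  open ObjMonoid M
  open StrictPremonoidal P
  private
    module L A = FunctorOver (leftWhisker A)
    module R A = FunctorOver (rightWhisker A)

  infixr 7 _⊠_
  -- The left factor runs first. Running the right factor first can give a different morphism unless
  -- one of the two is central.
  _⊠_ : ∀ {X Y X′ Y′} → Hom X Y → Hom X′ Y′ → Hom (X ⊗ X′) (Y ⊗ Y′)
  u ⊠ v = (u ⋊ _) ⨾ (_ ⋉ v)

  ⊠-idˡ : ∀ {A X Y} (v : Hom X Y) → idn {A} ⊠ v ≡ A ⋉ v
  ⊠-idˡ v = ≡.trans (cong (_⨾ (_ ⋉ v)) (R.map-id _)) (identityˡ _)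

  ⊠-idʳ : ∀ {A X Y} (u : Hom X Y) → u ⊠ idn {A} ≡ u ⋊ A
  ⊠-idʳ u = ≡.trans (cong ((u ⋊ _) ⨾_) (L.map-id _)) (identityʳ _)

  -- Both sides run `u`, `v`, `w` in this order, so no factors change places: after distributing the
  -- whiskering over `⨾`, corresponding factors match by `⋊-⊗`, `⋉-⋊` and `⊗-⋉`.
  ⊠-assoc : ∀ {X Y X′ Y′ X″ Y″} (u : Hom X Y) (v : Hom X′ Y′) (w : Hom X″ Y″) →
            (u ⊠ v) ⊠ w ≅ u ⊠ (v ⊠ w)
  ⊠-assoc {X} {Y} {X′} {Y′} {X″} {Y″} u v w = begin
    (u ⊠ v) ⊠ w
      ≡⟨ cong (_⨾ _) (R.map-comp X″ _ _) ⟩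
    (((u ⋊ X′) ⋊ X″) ⨾ ((Y ⋉ v) ⋊ X″)) ⨾ ((Y ⊗ Y′) ⋉ w)
      ≡⟨ assoc _ _ _ ⟩
    ((u ⋊ X′) ⋊ X″) ⨾ (((Y ⋉ v) ⋊ X″) ⨾ ((Y ⊗ Y′) ⋉ w))
      ≅⟨ ⨾-≅ cat (⊗-assoc _ _ _) (⊗-assoc _ _ _) (⊗-assoc _ _ _)
           (≅.sym (⋊-⊗ X′ X″ u))
           (⨾-≅ cat (⊗-assoc _ _ _) (⊗-assoc _ _ _) (⊗-assoc _ _ _)
             (⋉-⋊ Y X″ v) (⊗-⋉ Y Y′ w)) ⟩
    (u ⋊ (X′ ⊗ X″)) ⨾ ((Y ⋉ (v ⋊ X″)) ⨾ (Y ⋉ (Y′ ⋉ w)))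
      ≡⟨ cong (_ ⨾_) (L.map-comp Y _ _) ⟨
    u ⊠ (v ⊠ w) ∎
    where open ≅-Reasoning

  -- The left side runs `u`, `v`, `u′`, `v′` and the right side `u`, `u′`, `v`, `v′`. The hypothesis
  -- is exactly the swap of `v` with `u′`.
  ⊠-interchange :
    ∀ {X Y Z X′ Y′ Z′} (u : Hom X Y) (u′ : Hom Y Z) (v : Hom X′ Y′) (v′ : Hom Y′ Z′) →
    (Y ⋉ v) ⨾ (u′ ⋊ Y′) ≡ (u′ ⋊ X′) ⨾ (Z ⋉ v) →
    (u ⊠ v) ⨾ (u′ ⊠ v′) ≡ (u ⨾ u′) ⊠ (v ⨾ v′)
  ⊠-interchange {X} {Y} {Z} {X′} {Y′} {Z′} u u′ v v′ commute = begin
    ((u ⋊ X′) ⨾ (Y ⋉ v)) ⨾ ((u′ ⋊ Y′) ⨾ (Z ⋉ v′))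
      ≡⟨ assoc _ _ _ ⟩
    (u ⋊ X′) ⨾ ((Y ⋉ v) ⨾ ((u′ ⋊ Y′) ⨾ (Z ⋉ v′)))
      ≡⟨ cong (_ ⨾_) (assoc _ _ _) ⟨
    (u ⋊ X′) ⨾ (((Y ⋉ v) ⨾ (u′ ⋊ Y′)) ⨾ (Z ⋉ v′))
      ≡⟨ cong (λ w → _ ⨾ (w ⨾ _)) commute ⟩
    (u ⋊ X′) ⨾ (((u′ ⋊ X′) ⨾ (Z ⋉ v)) ⨾ (Z ⋉ v′))
      ≡⟨ cong (_ ⨾_) (assoc _ _ _) ⟩
    (u ⋊ X′) ⨾ ((u′ ⋊ X′) ⨾ ((Z ⋉ v) ⨾ (Z ⋉ v′)))
      ≡⟨ assoc _ _ _ ⟨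
    ((u ⋊ X′) ⨾ (u′ ⋊ X′)) ⨾ ((Z ⋉ v) ⨾ (Z ⋉ v′))
      ≡⟨ cong₂ _⨾_ (R.map-comp X′ _ _) (L.map-comp Z _ _) ⟨
    (u ⨾ u′) ⊠ (v ⨾ v′) ∎
    where open ≡.≡-Reasoning

module _ {o o′ ℓ ℓ′} {M : ObjMonoid o} {N : ObjMonoid o′}
         {P : StrictPremonoidal M ℓ} {Q : StrictPremonoidal N ℓ′}
         {h : ObjMonoid.Obj M → ObjMonoid.Obj N} (F : StrictPremonoidalFunctor P Q h) where
  private
    module P = StrictPremonoidal P
    module Q = StrictPremonoidal Q
    module P⊠ = Sequential P
    module Q⊠ = Sequential Q
  open StrictPremonoidalFunctor F
  open MonoidMorphisms.IsMonoidHomomorphism isHom using (homo)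

  map-⊠ : ∀ {X Y X′ Y′} (u : P.Hom X Y) (v : P.Hom X′ Y′) →
          map (u P⊠.⊠ v) ≅ map u Q⊠.⊠ map v
  map-⊠ u v = ≅.trans (≡-to-≅ (map-comp _ _))
    (⨾-≅ Q.cat (homo _ _) (homo _ _) (homo _ _) (map-⋊ _ u) (map-⋉ _ v))

premonoidal-⊠ : ∀ {o ℓ} {M : ObjMonoid o} (V : StrictMonoidal M ℓ) →
                let open StrictMonoidal V; open Sequential (premonoidal V) in
                ∀ {X Y X′ Y′} (f : Hom X Y) (g : Hom X′ Y′) → f ⊠ g ≡ f ⊗₁ g
premonoidal-⊠ V f g =
  ≡.trans (⊗₁-comp f idn idn g) (cong₂ _⊗₁_ (identityʳ f) (identityˡ g))
  where open StrictMonoidal V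

-- From effectful to graded categories.

module EffectfulToGraded {o ℓ} (A : Effectful o ℓ) where
  open Effectful A
  open Sequential C
  open C using (_⋉_; _⋊_)
  open V using (_⊗₁_)

  -- As a premonoidal functor `η` preserves whiskerings, hence `⊠`, and in the monoidal category `V`
  -- the product `⊠` is the tensor. Since `η` fixes objects, the heterogeneous equation is
  -- homogeneous.
  η-⊗₁ : ∀ {X Y X′ Y′} (f : V.Hom X Y) (g : V.Hom X′ Y′) →
         η.map (f ⊗₁ g) ≡ η.map f ⊠ η.map g
  η-⊗₁ f g = ≡.trans (cong η.map (≡.sym (premonoidal-⊠ V f g))) (≅-to-≡ (map-⊠ η f g))

  cat : Fin 2 → CategoryOn Obj ℓ
  cat 0F = V.cat
  cat 1F = C.cat

  private
    Hom : Fin 2 → Obj → Obj → Set ℓ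
    Hom a = CategoryOn.Hom (cat a)

    idₘ : ∀ X → Hom 0F X X
    idₘ X = V.idn

  regrade : ∀ {a b} → a ≤ b → FunctorOver (cat a) (cat b) id
  regrade {0F} {0F} _ = idOver V.cat
  regrade {0F} {1F} _ = η.functor
  regrade {1F} {1F} _ = idOver C.cat
  regrade {1F} {0F} p = ⊥-elim (1≰0 p)

  private
    _↑_ : ∀ {a b X Y} → Hom a X Y → a ≤ b → Hom b X Y
    f ↑ p = FunctorOver.map (regrade p) f

  tensor : ∀ {a b c} → a ⊕ b ≡ just c → ∀ {X Y X′ Y′} →
           Hom a X Y → Hom b X′ Y′ → Hom c (X ⊗ X′) (Y ⊗ Y′)
  tensor {0F} {0F} refl f g = f ⊗₁ g
  tensor {0F} {1F} refl f g = η.map f ⊠ g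
  tensor {1F} {0F} refl f g = f ⊠ η.map g
  tensor {1F} {1F} ()

  regrade-refl : ∀ {a X Y} (p : a ≤ a) (f : Hom a X Y) → f ↑ p ≡ f
  regrade-refl {0F} p f = refl
  regrade-refl {1F} p f = refl

  regrade-trans : ∀ {a b c X Y} (p : a ≤ b) (q : b ≤ c) (r : a ≤ c) (f : Hom a X Y) →
                  (f ↑ p) ↑ q ≡ f ↑ r
  regrade-trans {0F} {0F} {0F} p q r f = refl
  regrade-trans {0F} {0F} {1F} p q r f = refl
  regrade-trans {0F} {1F} {1F} p q r f = refl
  regrade-trans {0F} {1F} {0F} p q r f = ⊥-elim (1≰0 q)
  regrade-trans {1F} {0F}      p q r f = ⊥-elim (1≰0 p)
  regrade-trans {1F} {1F} {0F} p q r f = ⊥-elim (1≰0 q)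
  regrade-trans {1F} {1F} {1F} p q r f = refl

  -- Since `1F ⊕ 1F` is undefined, at most one factor can be raised. If none is, both sides
  -- coincide; raising one of two pure factors turns the equation into `η-⊗₁`.
  regrade-tensor : ∀ {a b c d ab cd X Y X′ Y′}
                   (p : a ≤ c) (q : b ≤ d)
                   (s : a ⊕ b ≡ just ab) (t : c ⊕ d ≡ just cd) (r : ab ≤ cd)
                   (f : Hom a X Y) (g : Hom b X′ Y′) →
                   tensor s f g ↑ r ≡ tensor t (f ↑ p) (g ↑ q)
  regrade-tensor {0F} {0F} {0F} {0F} p q refl refl r f g = refl
  regrade-tensor {0F} {0F} {0F} {1F} p q refl refl r f g = η-⊗₁ f g
  regrade-tensor {0F} {0F} {1F} {0F} p q refl refl r f g = η-⊗₁ f g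
  regrade-tensor {0F} {1F} {0F} {1F} p q refl refl r f g = refl
  regrade-tensor {1F} {0F} {1F} {0F} p q refl refl r f g = refl
  regrade-tensor {b = 1F} {d = 0F}  p q s t r f g = ⊥-elim (1≰0 q)
  regrade-tensor {1F}     {c = 0F}  p q s t r f g = ⊥-elim (1≰0 p)
  regrade-tensor {1F} {1F} p q ()
  regrade-tensor {c = 1F} {1F} p q s ()

  tensor-identityʳ : ∀ {a X Y} (s : a ⊕ 0F ≡ just a) (f : Hom a X Y) →
                     tensor s f (idₘ I) ≅ f
  tensor-identityʳ {0F} refl f = V.⊗₁-identityʳ f
  tensor-identityʳ {1F} refl f =
    ≅.trans (≡-to-≅ (≡.trans (cong (f ⊠_) η.map-id) (⊠-idʳ f))) (C.⋊-I f)

  tensor-identityˡ : ∀ {a X Y} (s : 0F ⊕ a ≡ just a) (f : Hom a X Y) →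
                     tensor {0F} s (idₘ I) f ≅ f
  tensor-identityˡ {0F} refl f = V.⊗₁-identityˡ f
  tensor-identityˡ {1F} refl f =
    ≅.trans (≡-to-≅ (≡.trans (cong (_⊠ f) η.map-id) (⊠-idˡ f))) (C.I-⋉ f)

  -- At most one of the three factors is effectful. If it is in the middle, this is `⊠-assoc`; if it
  -- is at an end, the tensor of the two pure factors is first split by `η-⊗₁`.
  tensor-assoc : ∀ {a b c ab bc abc X Y X′ Y′ X″ Y″}
                 (s : a ⊕ b ≡ just ab) (t : ab ⊕ c ≡ just abc)
                 (u : b ⊕ c ≡ just bc) (v : a ⊕ bc ≡ just abc)
                 (f : Hom a X Y) (g : Hom b X′ Y′) (h : Hom c X″ Y″) →
                 tensor t (tensor s f g) h ≅ tensor v f (tensor u g h)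
  tensor-assoc {0F} {0F} {0F} refl refl refl refl f g h = V.⊗₁-assoc f g h
  tensor-assoc {0F} {0F} {1F} refl refl refl refl f g h =
    ≅.trans (≡-to-≅ (cong (_⊠ h) (η-⊗₁ f g))) (⊠-assoc _ _ h)
  tensor-assoc {0F} {1F} {0F} refl refl refl refl f g h = ⊠-assoc _ g _
  tensor-assoc {1F} {0F} {0F} refl refl refl refl f g h =
    ≅.trans (⊠-assoc f _ _) (≡-to-≅ (cong (f ⊠_) (≡.sym (η-⊗₁ g h))))
  tensor-assoc {0F} {1F} {1F} s t ()
  tensor-assoc {1F} {0F} {1F} refl ()
  tensor-assoc {1F} {1F} ()

  tensor-id : ∀ {X Y} (s : 0F ⊕ 0F ≡ just 0F) → tensor {0F} {0F} s (idₘ X) (idₘ Y) ≡ idₘ (X ⊗ Y)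
  tensor-id refl = V.⊗₁-id

  interchange : ∀ {a b c X Y Z X′ Y′ Z′} (s : a ⊕ b ≡ just c)
                (f : Hom a X Y) (h : Hom a Y Z) (g : Hom b X′ Y′) (k : Hom b Y′ Z′) →
                CategoryOn._⨾_ (cat c) (tensor s f g) (tensor s h k) ≡
                tensor s (CategoryOn._⨾_ (cat a) f h) (CategoryOn._⨾_ (cat b) g k)
  interchange {0F} {0F} refl f h g k = V.⊗₁-comp f h g k
  -- The middle factors are `g` and the image of `h`, which is central. In the other mixed case the
  -- image of `g` is central and has to pass `h`, so `centralˡ` is read backwards.
  interchange {0F} {1F} refl f h g k = ≡.trans
    (⊠-interchange _ _ g k (C.Central.centralʳ (η-central h) g))
    (cong (_⊠ _) (≡.sym (η.map-comp f h)))
  interchange {1F} {0F} refl f h g k = ≡.trans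
    (⊠-interchange f h _ _ (≡.sym (C.Central.centralˡ (η-central g) h)))
    (cong (_ ⊠_) (≡.sym (η.map-comp g k)))
  interchange {1F} {1F} ()

  graded : GradedMonoidal 𝟚 o ℓ
  graded = record
    { monoid           = monoid
    ; cat              = cat
    ; regrade          = regrade
    ; tensor           = tensor
    ; regrade-refl     = regrade-refl
    ; regrade-trans    = regrade-trans
    ; regrade-tensor   = regrade-tensor
    ; tensor-identityʳ = tensor-identityʳ
    ; tensor-identityˡ = tensor-identityˡ
    ; tensor-assoc     = tensor-assoc
    ; tensor-id        = tensor-id
    ; interchange      = interchange
    }

open EffectfulToGraded using (graded)

-- From graded to effectful categories.

module GradedToEffectful {o ℓ} (G : GradedMonoidal 𝟚 o ℓ) where
  open GradedMonoidal G
  private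
    module C₀ = CategoryOn (cat 0F)
    module C₁ = CategoryOn (cat 1F)
    module η = FunctorOver (regrade {0F} {1F} 0≤1)

    0≤0 : 0F ≤ 0F
    0≤0 = 0F , refl

    infixr 7 _⊗₀₀_ _⊗₀₁_ _⊗₁₀_
    _⊗₀₀_ : ∀ {X Y X′ Y′} → C₀.Hom X Y → C₀.Hom X′ Y′ → C₀.Hom (X ⊗ X′) (Y ⊗ Y′)
    _⊗₀₀_ = tensor refl

    _⊗₀₁_ : ∀ {X Y X′ Y′} → C₀.Hom X Y → C₁.Hom X′ Y′ → C₁.Hom (X ⊗ X′) (Y ⊗ Y′)
    _⊗₀₁_ = tensor refl

    _⊗₁₀_ : ∀ {X Y X′ Y′} → C₁.Hom X Y → C₀.Hom X′ Y′ → C₁.Hom (X ⊗ X′) (Y ⊗ Y′)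
    _⊗₁₀_ = tensor refl

  -- As `1F` is both `1F ⊕ 0F` and `0F ⊕ 1F`, raising a pure tensor may be charged to either factor:
  -- to the left one here, to the right one in `η-⊗ʳ`. The other factor is regraded along `0≤0`,
  -- which `regrade-refl` removes.
  η-⊗ˡ : ∀ {X Y X′ Y′} (f : C₀.Hom X Y) (g : C₀.Hom X′ Y′) →
         η.map (f ⊗₀₀ g) ≡ η.map f ⊗₁₀ g
  η-⊗ˡ f g = ≡.trans (regrade-tensor 0≤1 0≤0 refl refl 0≤1 f g)
                     (cong (_ ⊗₁₀_) (regrade-refl 0≤0 g))

  η-⊗ʳ : ∀ {X Y X′ Y′} (f : C₀.Hom X Y) (g : C₀.Hom X′ Y′) →
         η.map (f ⊗₀₀ g) ≡ f ⊗₀₁ η.map g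
  η-⊗ʳ f g = ≡.trans (regrade-tensor 0≤0 0≤1 refl refl 0≤1 f g)
                     (cong (_⊗₀₁ _) (regrade-refl 0≤0 f))

  -- Both sides are `η.map (f ⊗₀₀ C₀.idn)`. Moving the effectful grade from `f` to the identity
  -- brings a whiskered `η.map f` into the form `⊗₀₁`, where it can be interchanged with an
  -- effectful right factor.
  ηf⊗id : ∀ {X Y A} (f : C₀.Hom X Y) → η.map f ⊗₁₀ C₀.idn {A} ≡ f ⊗₀₁ C₁.idn
  ηf⊗id f = ≡.trans (≡.sym (η-⊗ˡ f C₀.idn))
                    (≡.trans (η-⊗ʳ f C₀.idn) (cong (f ⊗₀₁_) η.map-id))

  id⊗ηf : ∀ {X Y A} (f : C₀.Hom X Y) → C₀.idn {A} ⊗₀₁ η.map f ≡ C₁.idn ⊗₁₀ f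
  id⊗ηf f = ≡.trans (≡.sym (η-⊗ʳ C₀.idn f))
                    (≡.trans (η-⊗ˡ C₀.idn f) (cong (_⊗₁₀ f) η.map-id))

  -- The axiom `tensor-id` speaks of grade `0F` only. It reaches grade `1F` because the identities
  -- there are regraded ones.
  id⊗₀₁id : ∀ {A B} → C₀.idn {A} ⊗₀₁ C₁.idn {B} ≡ C₁.idn
  id⊗₀₁id = begin
    C₀.idn ⊗₀₁ C₁.idn          ≡⟨ cong (_ ⊗₀₁_) η.map-id ⟨
    C₀.idn ⊗₀₁ η.map C₀.idn    ≡⟨ η-⊗ʳ _ _ ⟨
    η.map (C₀.idn ⊗₀₀ C₀.idn)  ≡⟨ cong η.map (tensor-id refl) ⟩
    η.map C₀.idn               ≡⟨ η.map-id ⟩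
    C₁.idn                     ∎
    where open ≡.≡-Reasoning

  id⊗₁₀id : ∀ {A B} → C₁.idn {A} ⊗₁₀ C₀.idn {B} ≡ C₁.idn
  id⊗₁₀id = begin
    C₁.idn ⊗₁₀ C₀.idn        ≡⟨ cong (_⊗₁₀ _) η.map-id ⟨
    η.map C₀.idn ⊗₁₀ C₀.idn  ≡⟨ ηf⊗id C₀.idn ⟩
    C₀.idn ⊗₀₁ C₁.idn        ≡⟨ id⊗₀₁id ⟩
    C₁.idn                   ∎
    where open ≡.≡-Reasoning

  V : StrictMonoidal monoid ℓ
  V = record
    { cat          = cat 0F
    ; _⊗₁_         = _⊗₀₀_
    ; ⊗₁-id        = tensor-id refl
    ; ⊗₁-comp      = interchange refl
    ; ⊗₁-identityˡ = tensor-identityˡ refl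
    ; ⊗₁-identityʳ = tensor-identityʳ refl
    ; ⊗₁-assoc     = tensor-assoc refl refl refl refl
    }

  C : StrictPremonoidal monoid ℓ
  C = record
    { cat          = cat 1F
    ; leftWhisker  = λ A → record
        { map      = C₀.idn {A} ⊗₀₁_
        ; map-id   = id⊗₀₁id
        ; map-comp = λ f g → ≡.sym (≡.trans (interchange refl _ _ f g)
                                            (cong (_⊗₀₁ (f C₁.⨾ g)) (C₀.identityˡ _)))
        }
    ; rightWhisker = λ A → record
        { map      = _⊗₁₀ C₀.idn {A}
        ; map-id   = id⊗₁₀id
        ; map-comp = λ f g → ≡.sym (≡.trans (interchange refl f g _ _)
                                            (cong ((f C₁.⨾ g) ⊗₁₀_) (C₀.identityˡ _)))
        }
    ; ⋉-⋊ = λ A B f → tensor-assoc refl refl refl refl _ f _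
    ; ⊗-⋉ = λ A B f → ≅.trans (≡-to-≅ (cong (_⊗₀₁ f) (≡.sym (tensor-id refl))))
                              (tensor-assoc refl refl refl refl _ _ f)
    ; ⋊-⊗ = λ A B f → ≅.trans (≡-to-≅ (cong (f ⊗₁₀_) (≡.sym (tensor-id refl))))
                              (≅.sym (tensor-assoc refl refl refl refl f _ _))
    ; I-⋉ = tensor-identityˡ refl
    ; ⋊-I = tensor-identityʳ refl
    }
  open StrictPremonoidal C using (_⋉_; _⋊_; Central)

  -- With `ηf⊗id` both whiskerings become tensors of the form `⊗₀₁`. Interchange then merges either
  -- order of composition, up to identities, into `f ⊗₀₁ g`.
  centralʳ : ∀ {A B X Y} (f : C₀.Hom A B) (g : C₁.Hom X Y) →
             (A ⋉ g) C₁.⨾ (η.map f ⋊ Y) ≡ (η.map f ⋊ X) C₁.⨾ (B ⋉ g)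
  centralʳ {A} {B} {X} {Y} f g = begin
    (C₀.idn ⊗₀₁ g) C₁.⨾ (η.map f ⋊ Y)       ≡⟨ cong ((C₀.idn ⊗₀₁ g) C₁.⨾_) (ηf⊗id f) ⟩
    (C₀.idn ⊗₀₁ g) C₁.⨾ (f ⊗₀₁ C₁.idn)      ≡⟨ interchange refl _ _ _ _ ⟩
    (C₀.idn C₀.⨾ f) ⊗₀₁ (g C₁.⨾ C₁.idn)
      ≡⟨ cong₂ _⊗₀₁_ (≡.trans (C₀.identityˡ f) (≡.sym (C₀.identityʳ f)))
                     (≡.trans (C₁.identityʳ g) (≡.sym (C₁.identityˡ g))) ⟩
    (f C₀.⨾ C₀.idn) ⊗₀₁ (C₁.idn C₁.⨾ g)     ≡⟨ interchange refl _ _ _ _ ⟨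
    (f ⊗₀₁ C₁.idn) C₁.⨾ (C₀.idn ⊗₀₁ g)      ≡⟨ cong (C₁._⨾ (C₀.idn ⊗₀₁ g)) (ηf⊗id f) ⟨
    (η.map f ⋊ X) C₁.⨾ (C₀.idn ⊗₀₁ g)       ∎
    where open ≡.≡-Reasoning

  centralˡ : ∀ {A B X Y} (f : C₀.Hom A B) (g : C₁.Hom X Y) →
             (g ⋊ A) C₁.⨾ (Y ⋉ η.map f) ≡ (X ⋉ η.map f) C₁.⨾ (g ⋊ B)
  centralˡ {A} {B} {X} {Y} f g = begin
    (g ⊗₁₀ C₀.idn) C₁.⨾ (Y ⋉ η.map f)       ≡⟨ cong ((g ⊗₁₀ C₀.idn) C₁.⨾_) (id⊗ηf f) ⟩
    (g ⊗₁₀ C₀.idn) C₁.⨾ (C₁.idn ⊗₁₀ f)      ≡⟨ interchange refl _ _ _ _ ⟩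
    (g C₁.⨾ C₁.idn) ⊗₁₀ (C₀.idn C₀.⨾ f)
      ≡⟨ cong₂ _⊗₁₀_ (≡.trans (C₁.identityʳ g) (≡.sym (C₁.identityˡ g)))
                     (≡.trans (C₀.identityˡ f) (≡.sym (C₀.identityʳ f))) ⟩
    (C₁.idn C₁.⨾ g) ⊗₁₀ (f C₀.⨾ C₀.idn)     ≡⟨ interchange refl _ _ _ _ ⟨
    (C₁.idn ⊗₁₀ f) C₁.⨾ (g ⊗₁₀ C₀.idn)      ≡⟨ cong (C₁._⨾ (g ⊗₁₀ C₀.idn)) (id⊗ηf f) ⟨
    (X ⋉ η.map f) C₁.⨾ (g ⊗₁₀ C₀.idn)       ∎
    where open ≡.≡-Reasoning

  effectful : Effectful o ℓ
  effectful = record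
    { monoid    = monoid
    ; V         = V
    ; C         = C
    ; η         = record
        { isHom   = isMonoidHom-id monoid
        ; functor = regrade {0F} {1F} 0≤1
        ; map-⋉   = λ A f → ≡-to-≅ (η-⊗ʳ C₀.idn f)
        ; map-⋊   = λ A f → ≡-to-≅ (η-⊗ˡ f C₀.idn)
        }
    ; η-central = λ f → record { centralʳ = centralʳ f ; centralˡ = centralˡ f }
    }

  open Sequential C using (_⊠_)

  -- Needed for the round trip: the mixed tensor rebuilt from whiskerings is the original one.
  -- Shifting the grade by `ηf⊗id` makes both factors of the composite `⊗₀₁` tensors, which
  -- interchange merges.
  ⊗₀₁-⊠ : ∀ {X Y X′ Y′} (f : C₀.Hom X Y) (g : C₁.Hom X′ Y′) → η.map f ⊠ g ≡ f ⊗₀₁ g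
  ⊗₀₁-⊠ f g = begin
    (η.map f ⊗₁₀ C₀.idn) C₁.⨾ (C₀.idn ⊗₀₁ g)  ≡⟨ cong (C₁._⨾ (C₀.idn ⊗₀₁ g)) (ηf⊗id f) ⟩
    (f ⊗₀₁ C₁.idn) C₁.⨾ (C₀.idn ⊗₀₁ g)        ≡⟨ interchange refl _ _ _ _ ⟩
    (f C₀.⨾ C₀.idn) ⊗₀₁ (C₁.idn C₁.⨾ g)       ≡⟨ cong₂ _⊗₀₁_ (C₀.identityʳ f) (C₁.identityˡ g) ⟩
    f ⊗₀₁ g                                   ∎
    where open ≡.≡-Reasoning

  ⊗₁₀-⊠ : ∀ {X Y X′ Y′} (f : C₁.Hom X Y) (g : C₀.Hom X′ Y′) → f ⊠ η.map g ≡ f ⊗₁₀ g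
  ⊗₁₀-⊠ f g = begin
    (f ⊗₁₀ C₀.idn) C₁.⨾ (C₀.idn ⊗₀₁ η.map g)  ≡⟨ cong ((f ⊗₁₀ C₀.idn) C₁.⨾_) (id⊗ηf g) ⟩
    (f ⊗₁₀ C₀.idn) C₁.⨾ (C₁.idn ⊗₁₀ g)        ≡⟨ interchange refl _ _ _ _ ⟩
    (f C₁.⨾ C₁.idn) ⊗₁₀ (C₀.idn C₀.⨾ g)       ≡⟨ cong₂ _⊗₁₀_ (C₁.identityʳ f) (C₀.identityˡ g) ⟩
    f ⊗₁₀ g                                   ∎
    where open ≡.≡-Reasoning

open GradedToEffectful using (effectful)

-- Action on morphisms, in both directions.

effectfulFunctor : ∀ {o ℓ} {G H : GradedMonoidal 𝟚 o ℓ} →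
                   GradedFunctor G H → EffectfulFunctor (effectful G) (effectful H)
effectfulFunctor {G = G} {H} F = record
  { onObj     = F₀
  ; F₀        = record
      { isHom   = isHom
      ; functor = functor 0F
      ; map-⊗₁  = map-tensor refl
      }
  ; F₁        = record
      { isHom   = isHom
      ; functor = functor 1F
      -- A whiskering is a tensor with a pure identity, so `map-tensor` leaves the image of that
      -- identity under `functor 0F`, which `map-id` simplifies.
      ; map-⋉   = λ A f → ≅.trans (map-tensor refl _ f)
          (≡-to-≅ (cong (λ g → H.tensor refl g (map f)) (FunctorOver.map-id (functor 0F))))
      ; map-⋊   = λ A f → ≅.trans (map-tensor refl f _)
          (≡-to-≅ (cong (H.tensor refl (map f)) (FunctorOver.map-id (functor 0F))))
      }
  ; F₁∘η≡η∘F₀ = map-regrade 0≤1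
  }
  where
    open GradedFunctor F
    module H = GradedMonoidal H

module _ {o ℓ} {A B : Effectful o ℓ} (F : EffectfulFunctor A B) where
  private
    module A = GradedMonoidal (graded A)
    module B = GradedMonoidal (graded B)
    module B⊠ = Sequential (Effectful.C B)
  open EffectfulFunctor F

  gradedFunctor : GradedFunctor (graded A) (graded B)
  gradedFunctor = record
    { F₀          = onObj
    ; isHom       = F₀.isHom
    ; functor     = functor
    ; map-tensor  = map-tensor
    ; map-regrade = map-regrade
    }
    where
    functor : ∀ a → FunctorOver (A.cat a) (B.cat a) onObj
    functor 0F = F₀.functor
    functor 1F = F₁.functor

    map : ∀ {a X Y} → A.Hom a X Y → B.Hom a (onObj X) (onObj Y)
    map {a} = FunctorOver.map (functor a)

    -- In the mixed cases `F₁` preserves `⊠`, and `F₁∘η≡η∘F₀` turns the image of the pure factor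
    -- into `η` of its image under `F₀`.
    map-tensor : ∀ {a b c X Y X′ Y′} (s : a ⊕ b ≡ just c)
                 (g : A.Hom a X Y) (h : A.Hom b X′ Y′) →
                 map {c} (A.tensor {a} {b} s g h) ≅ B.tensor {a} {b} s (map {a} g) (map {b} h)
    map-tensor {0F} {0F} refl g h = F₀.map-⊗₁ g h
    map-tensor {0F} {1F} refl g h = ≅.trans (map-⊠ F₁ _ h)
      (≡-to-≅ (cong (B⊠._⊠ F₁.map h) (F₁∘η≡η∘F₀ g)))
    map-tensor {1F} {0F} refl g h = ≅.trans (map-⊠ F₁ g _)
      (≡-to-≅ (cong (F₁.map g B⊠.⊠_) (F₁∘η≡η∘F₀ h)))
    map-tensor {1F} {1F} ()

    map-regrade : ∀ {a b X Y} (p : a ≤ b) (g : A.Hom a X Y) →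
                  map {b} (A._↑_ {a} {b} g p) ≡ B._↑_ {a} {b} (map {a} g) p
    map-regrade {0F} {0F} p g = refl
    map-regrade {0F} {1F} p g = F₁∘η≡η∘F₀ g
    map-regrade {1F} {1F} p g = refl
    map-regrade {1F} {0F} p g = ⊥-elim (1≰0 p)

-- The two constructions are mutually inverse on objects.

module _ (ext : FunExt) where

  -- The two families of categories over Fin 2 agree at each grade by refl, but
  -- are equal as functions only by extensionality; hence the heterogeneous
  -- comparison of everything that lives over them.
  graded∘effectful : ∀ {o ℓ} (G : GradedMonoidal 𝟚 o ℓ) → graded (effectful G) ≡ G
  graded∘effectful G = GradedMonoidal-≡ ext refl (≡-to-≅ (ext cat-≡))
    (≅-iext ext λ a → ≅-iext ext λ b → ≅-ext ext (regrade-≅ a b))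
    (≅-iext ext λ a → ≅-iext ext λ b → ≅-iext ext λ c → ≅-ext ext (tensor-≅ a b c))
    where
    module G = GradedMonoidal G
    module G′ = GradedMonoidal (graded (effectful G))
    open GradedToEffectful G using (⊗₀₁-⊠; ⊗₁₀-⊠)

    cat-≡ : ∀ a → G′.cat a ≡ G.cat a
    cat-≡ 0F = refl
    cat-≡ 1F = refl

    -- Regrading along any witness of `a ≤ a` is the identity by `regrade-refl`. A witness of
    -- `0F ≤ 1F` must have first component `1F`, so matching on `refl` turns it into `0≤1`.
    regrade-≅ : ∀ a b (p : a ≤ b) → G′.regrade {a} {b} p ≅ G.regrade {a} {b} p
    regrade-≅ 0F 0F p = ≡-to-≅ (FunctorOver-≡ ext λ f → ≡.sym (G.regrade-refl p f))
    regrade-≅ 0F 1F (_ , refl) = refl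
    regrade-≅ 1F 1F p = ≡-to-≅ (FunctorOver-≡ ext λ f → ≡.sym (G.regrade-refl p f))
    regrade-≅ 1F 0F p = ⊥-elim (1≰0 p)

    tensor-≅ : ∀ a b c (s : a ⊕ b ≡ just c) →
               (λ {X Y X′ Y′} → G′.tensor {a} {b} s {X} {Y} {X′} {Y′}) ≅
               (λ {X Y X′ Y′} → G.tensor {a} {b} s {X} {Y} {X′} {Y′})
    tensor-≅ 0F 0F _ refl = refl
    tensor-≅ 0F 1F _ refl = ≡-to-≅
      (iext ext (iext ext (iext ext (iext ext (ext λ f → ext λ g → ⊗₀₁-⊠ f g)))))
    tensor-≅ 1F 0F _ refl = ≡-to-≅
      (iext ext (iext ext (iext ext (iext ext (ext λ f → ext λ g → ⊗₁₀-⊠ f g)))))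
    tensor-≅ 1F 1F _ ()

  module _ {o ℓ} (A : Effectful o ℓ) where
    private module A = Effectful A

    -- The recovered whiskering by an object is `⊠` with the image under `η` of an identity of `V`.
    -- Since `η` preserves identities, `⊠-idˡ` and `⊠-idʳ` give back the original whiskerings.
    effectful∘graded-C : GradedToEffectful.C (graded A) ≡ A.C
    effectful∘graded-C = StrictPremonoidal-≡ ext refl
      (≡-to-≅ (ext λ X → FunctorOver-≡ ext λ f →
        ≡.trans (cong (_⊠ f) A.η.map-id) (⊠-idˡ f)))
      (≡-to-≅ (ext λ X → FunctorOver-≡ ext λ f →
        ≡.trans (cong (f ⊠_) A.η.map-id) (⊠-idʳ f)))
      where open Sequential A.C

    -- V and the action of η are recovered definitionally, because graded
    -- computes at grade 0F to the fields of V.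
    effectful∘graded : effectful (graded A) ≡ A
    effectful∘graded = Effectful-≡ ext refl refl (≡-to-≅ effectful∘graded-C)
      (StrictPremonoidalFunctor-≅ ext refl effectful∘graded-C refl)

-- The isomorphism of categories.

proposition4p2 : (ext : FunExt) (o ℓ : Level) →
    IsomorphicCategories (GradMon ext 𝟚 o ℓ) (Eff ext o ℓ)
proposition4p2 ext o ℓ = record
  { to      = to
  ; from    = from
  ; from∘to = Functor-≡ ext (graded∘effectful ext) λ {G} {H} F →
      GradedFunctor-≅ ext (graded∘effectful ext G) (graded∘effectful ext H) refl
        -- The rebuilt family of functors is defined by cases on the grade, so it agrees with the
        -- original one only grade by grade.
        (≅-ext ext λ { 0F → refl ; 1F → refl })
  ; to∘from = Functor-≡ ext (effectful∘graded ext) λ {A} {B} F →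
      EffectfulFunctor-≅ ext (effectful∘graded ext A) (effectful∘graded ext B) refl refl
        -- `F₁` comes back with the same underlying functor, but between the rebuilt premonoidal
        -- categories and with the homomorphism proof of `F₀`.
        (StrictPremonoidalFunctor-≅ ext (effectful∘graded-C ext A) (effectful∘graded-C ext B) refl)
  }
  where
  to : Functor (GradMon ext 𝟚 o ℓ) (Eff ext o ℓ)
  to = record
    { F₀          = effectful
    ; functorOver = record
        { map      = effectfulFunctor
        ; map-id   = EffectfulFunctor-≡ ext refl
            (≡-to-≅ (StrictMonoidalFunctor-≡ ext refl))
            (≡-to-≅ (StrictPremonoidalFunctor-≡ ext refl))
        ; map-comp = λ F G → EffectfulFunctor-≡ ext refl
            (≡-to-≅ (StrictMonoidalFunctor-≡ ext refl))
            (≡-to-≅ (StrictPremonoidalFunctor-≡ ext refl))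
        }
    }

  from : Functor (Eff ext o ℓ) (GradMon ext 𝟚 o ℓ)
  from = record
    { F₀          = graded
    ; functorOver = record
        { map      = gradedFunctor
        ; map-id   = GradedFunctor-≡ ext refl (≅-ext ext λ { 0F → refl ; 1F → refl })
        ; map-comp = λ F G → GradedFunctor-≡ ext refl (≅-ext ext λ { 0F → refl ; 1F → refl })
        }
    }
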